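{- Let $d \in \mathbb{N}$ be any power of $2$. For all sufficiently large $n$, there exists a Boolean function $F:\{0,1\}^{2n}\to\{0,1\}$ such that $$\gamma_{2d,2}(F) \ge \frac{3}{4} - o(1) \quad\text{and}\quad \gamma_{3d-1,1}(F) \le \frac{5}{8} + o(1),$$ where the $o(1)$ terms tend to $0$ as $n\to\infty$ (with $d$ fixed).
   Context: For a Boolean function $F:\{0,1\}^m\to\{0,1\}$ and $k\ge 1$, the $k$-lift of $F$ is $F_k:\{0,1\}^m\to \mathbb{Z}/2^k\mathbb{Z}$ with $F_k(x)=0$ if $F(x)=0$ and $F_k(x)=2^{k-1}$ if $F(x)=1$. $\mathcal{P}_{d,k}$ denotes the set of multilinear polynomials in the $m$ input variables of degree at most $d$ with coefficients in $\mathbb{Z}/2^k\mathbb{Z}$, evaluated on $\{0,1\}^m$. $\mathrm{agr}(F,G)=\Pr_{x}[F(x)=G(x)]$ for $x$ uniform on the domain, and $\gamma_{d,k}(F)=\max_{Q\in\mathcal{P}_{d,k}}\mathrm{agr}(F_k,Q)$. -}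

module Defs where

open import Data.Bool using (Bool; true; false; if_then_else_)
open import Data.Nat as ℕ using (ℕ; zero; suc; _+_; _*_; _^_; _∸_; _≤ᵇ_; _%_)
open import Data.Nat.Properties using (m^n≢0; _≟_)
open import Data.Fin using (Fin; toℕ)
open import Data.Vec using (Vec; []; _∷_)
open import Data.List using (List; []; _∷_; map; concatMap; foldr; filterᵇ; length; allFin)
open import Data.Nat.ListAction using (sum)
open import Data.Integer using (+_)
open import Data.Rational using (ℚ; _/_; _⊔_; 0ℚ)
open import Relation.Nullary.Decidable using (does)

cube : (m : ℕ) → List (Vec Bool m)
cube zero    = [] ∷ []
cube (suc m) = concatMap (λ v → (false ∷ v) ∷ (true ∷ v) ∷ []) (cube m)

-- A monomial is a subset S ⊆ [m] (indicator vector); its degree is |S|.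
popcount : ∀ {m} → Vec Bool m → ℕ
popcount []            = 0
popcount (false ∷ v)   = popcount v
popcount (true  ∷ v)   = suc (popcount v)

monomials : (m d : ℕ) → List (Vec Bool m)
monomials m d = filterᵇ (λ S → popcount S ≤ᵇ d) (cube m)

monoVal : ∀ {m} → Vec Bool m → Vec Bool m → ℕ
monoVal []          []          = 1
monoVal (false ∷ S) (_ ∷ x)     = monoVal S x
monoVal (true  ∷ S) (false ∷ x) = 0
monoVal (true  ∷ S) (true  ∷ x) = monoVal S x

-- Z/2^k Z represented as Fin (2^k).
-- A polynomial in P_{d,k}: a coefficient in Z/2^k for each monomial of degree ≤ d,
-- given as a list of (monomial, coefficient) pairs.
record Term (m k : ℕ) : Set where
  constructor term
  field
    mono  : Vec Bool m
    coeff : Fin (2 ^ k)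

Poly : ℕ → ℕ → Set
Poly m k = List (Term m k)

assignments : ∀ {m} (k : ℕ) → List (Vec Bool m) → List (Poly m k)
assignments k []       = [] ∷ []
assignments k (S ∷ Ss) =
  concatMap (λ p → map (λ c → term S c ∷ p) (allFin (2 ^ k))) (assignments k Ss)

polys : (m d k : ℕ) → List (Poly m k)
polys m d k = assignments k (monomials m d)

eval : ∀ {m k} → Poly m k → Vec Bool m → ℕ
eval {k = k} p x =
  (sum (map (λ t → toℕ (Term.coeff t) * monoVal (Term.mono t) x) p)) % (2 ^ k)
  where instance _ = m^n≢0 2 k

lift : ∀ {m} (k : ℕ) → (Vec Bool m → Bool) → Vec Bool m → ℕ
lift k F x = if F x then 2 ^ (k ∸ 1) else 0

agr : ∀ {m} (k : ℕ) → (Vec Bool m → Bool) → Poly m k → ℚ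
agr {m} k F Q =
  (+ length (filterᵇ (λ x → does (lift k F x ≟ eval Q x)) (cube m))) / (2 ^ m)
  where instance _ = m^n≢0 2 m

-- γ_{d,k}(F) = max_{Q ∈ P_{d,k}} agr(F_k, Q).
-- (P_{d,k} is nonempty and all agreements are ≥ 0, so starting the fold at 0 is harmless.)
γ : ∀ {m} (d k : ℕ) → (Vec Bool m → Bool) → ℚ
γ {m} d k F = foldr (λ Q r → agr k F Q ⊔ r) 0ℚ (polys m d k)

{-# OPTIONS --safe #-}
module Submission where

-- Let w and v be the weights of the two halves of the input, put a₀ = C(w,d) and a₁ = C(w,2d) mod 2, define b₀, b₁
-- likewise from v, and take F = a₁b₀ + a₀b₁.  As d is a power of 2, C(w,d) ≡ 2a₁ mod 4 whenever C(w,d) is even, so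
-- e_d(x) e_d(y) mod 4 equals the 2-lift of F except where a₀ = b₀ = 1, on about a quarter of the cube.
--
-- For the upper bound (after Alon and Beigel), Ramsey's theorem yields a large set of variables on which the top
-- part of a competing polynomial is symmetric in x and in y.  Averaging over the values of the other variables, that
-- part can be moved into the target, and after finitely many rounds only a function G(w,v) is left, to be compared
-- with 0.  Since (1 + t)^d ≡ 1 + t^d mod 2, a shift of a weight by d lowers degrees by d, so the third-order
-- differences of G of step d are those of F.  This forces G to be nonzero at 6 or more of the 16 points of every
-- 4 × 4 grid of step d, and the weights are asymptotically equidistributed along such grids.

open import Defs

-- By Lucas' theorem a₀ and a₁ are the binary digits of w at the places of d and 2d, and likewise b₀
-- and b₁ for v, so F is a bent function of four digits. On a 4 × 4 grid of step d with coordinates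
-- i and j, Newton's formula writes every function with the third differences of F as i₁j₀ + i₀j₁ +
-- c i₀j₀ plus an affine function of the digits of i and j. The quadratic part is nondegenerate for
-- both values of c, so the function is again bent and takes the value 1 at 6 or 10 of the 16
-- points. This is the origin of 3/8 and hence of 5/8.
--
-- Every round of the upper bound replaces the target by another function and the cube by subcubes.
-- The induction therefore runs over all targets with the prescribed third differences, and the
-- sizes supplied by Ramsey's theorem depend on neither the target nor the polynomial. A lower bound
-- for the disagreement that holds on each subcube holds on the whole cube, so the rounds lose
-- nothing: the error 1/e arises only at the end, from equidistribution.

module Agreement where

  open import Data.Bool using (Bool; true; false; not; _∧_; _xor_; if_then_else_; T)
  open import Data.Bool.Properties as 𝔹 using (xor-same; xor-identityʳ)
  open import Data.Empty using (⊥; ⊥-elim)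
  open import Data.Fin using (Fin; toℕ) renaming (zero to 0F; suc to sucF)
  open import Data.List as List using (List; []; _∷_; map; filterᵇ; length)
  open import Data.List.Membership.Propositional using (_∈_)
  open import Data.List.Membership.Propositional.Properties using (∈-map⁺; ∈-concatMap⁺; ∈-allFin)
  open import Data.List.Properties using (map-∘)
  open import Data.List.Relation.Unary.All as All using (All; []; _∷_)
  import Data.List.Relation.Unary.All.Properties as Allₚ
  open import Data.List.Relation.Unary.Any as Any using (here; there)
  open import Data.Nat
    using (ℕ; zero; suc; _+_; _*_; _^_; _∸_; _⊔_; _≤_; _<_; z≤n; s≤s; _≡ᵇ_; _≤ᵇ_; _%_; _/_; NonZero; >-nonZero)
  open import Data.Nat.DivMod using (m≡m%n+[m/n]*n; m%n<n; [m+kn]%n≡m%n)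
  open import Data.Nat.ListAction using (sum)
  open import Data.Nat.Properties
  open import Data.Nat.Tactic.RingSolver using (solve-∀)
  open import Data.Product using (∃; ∃₂; _×_; _,_; proj₁; proj₂)
  open import Data.Sum using (_⊎_; inj₁; inj₂; [_,_]′)
  open import Data.Vec using (Vec; []; _∷_; _++_; splitAt)
  open import Function using (_∘_)
  open import Relation.Binary.PropositionalEquality
    using (_≡_; refl; sym; trans; cong; cong₂; subst; module ≡-Reasoning)
  open import Relation.Nullary.Decidable using (Dec; yes; no; does; dec-true; from-yes; map′; T?; _×-dec_)

  interchange : ∀ a b c d → (a + b) + (c + d) ≡ (a + c) + (b + d)
  interchange = solve-∀

  bit : Bool → ℕ
  bit b = if b then 1 else 0

  -- Sums over the cube

  ∑ : ∀ n → (Vec Bool n → ℕ) → ℕ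
  ∑ zero    f = f []
  ∑ (suc n) f = ∑ n (λ v → f (false ∷ v) + f (true ∷ v))

  ∑-cong : ∀ n {f g : Vec Bool n → ℕ} → (∀ v → f v ≡ g v) → ∑ n f ≡ ∑ n g
  ∑-cong zero    f≗g = f≗g []
  ∑-cong (suc n) f≗g = ∑-cong n (λ v → cong₂ _+_ (f≗g (false ∷ v)) (f≗g (true ∷ v)))

  ∑-mono : ∀ n {f g : Vec Bool n → ℕ} → (∀ v → f v ≤ g v) → ∑ n f ≤ ∑ n g
  ∑-mono zero    f≤g = f≤g []
  ∑-mono (suc n) f≤g = ∑-mono n (λ v → +-mono-≤ (f≤g (false ∷ v)) (f≤g (true ∷ v)))

  ∑-+ : ∀ n (f g : Vec Bool n → ℕ) → ∑ n (λ v → f v + g v) ≡ ∑ n f + ∑ n g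
  ∑-+ zero    f g = refl
  ∑-+ (suc n) f g = trans
    (∑-cong n (λ v → interchange (f (false ∷ v)) (g (false ∷ v)) (f (true ∷ v)) (g (true ∷ v))))
    (∑-+ n (λ v → f (false ∷ v) + f (true ∷ v)) (λ v → g (false ∷ v) + g (true ∷ v)))

  ∑-const : ∀ n k → ∑ n (λ _ → k) ≡ k * 2 ^ n
  ∑-const zero    k = sym (*-identityʳ k)
  ∑-const (suc n) k = trans (∑-const n (k + k)) (double k (2 ^ n))
    where
    double : ∀ k t → (k + k) * t ≡ k * (t + (t + 0))
    double = solve-∀

  ∑-zero : ∀ n {f : Vec Bool n → ℕ} → (∀ v → f v ≡ 0) → ∑ n f ≡ 0
  ∑-zero n f≗0 = trans (∑-cong n f≗0) (∑-const n 0)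

  -- Sums over the Hamming weights of a cube

  W : ℕ → (ℕ → ℕ) → ℕ
  W zero    f = f 0
  W (suc n) f = W n (λ w → f w + f (suc w))

  W-cong : ∀ n {f g : ℕ → ℕ} → (∀ w → f w ≡ g w) → W n f ≡ W n g
  W-cong zero    f≗g = f≗g 0
  W-cong (suc n) f≗g = W-cong n (λ w → cong₂ _+_ (f≗g w) (f≗g (suc w)))

  W-mono : ∀ n {f g : ℕ → ℕ} → (∀ w → f w ≤ g w) → W n f ≤ W n g
  W-mono zero    f≤g = f≤g 0
  W-mono (suc n) f≤g = W-mono n (λ w → +-mono-≤ (f≤g w) (f≤g (suc w)))

  W-+ : ∀ n (f g : ℕ → ℕ) → W n (λ w → f w + g w) ≡ W n f + W n g
  W-+ zero    f g = refl
  W-+ (suc n) f g = trans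
    (W-cong n (λ w → interchange (f w) (g w) (f (suc w)) (g (suc w))))
    (W-+ n (λ w → f w + f (suc w)) (λ w → g w + g (suc w)))

  W-const : ∀ n k → W n (λ _ → k) ≡ 2 ^ n * k
  W-const zero    k = sym (*-identityˡ k)
  W-const (suc n) k = trans (W-const n (k + k)) (double k (2 ^ n))
    where
    double : ∀ k t → t * (k + k) ≡ (t + (t + 0)) * k
    double = solve-∀

  W-* : ∀ n k (f : ℕ → ℕ) → W n (λ w → k * f w) ≡ k * W n f
  W-* zero    k f = refl
  W-* (suc n) k f = trans
    (W-cong n (λ w → sym (*-distribˡ-+ k (f w) (f (suc w)))))
    (W-* n k (λ w → f w + f (suc w)))

  W-swap : ∀ m n (f : ℕ → ℕ → ℕ) → W m (λ a → W n (f a)) ≡ W n (λ b → W m (λ a → f a b))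
  W-swap zero    n f = refl
  W-swap (suc m) n f = trans
    (W-cong m (λ a → sym (W-+ n (f a) (f (suc a)))))
    (W-swap m n (λ a b → f a b + f (suc a) b))

  -- Vandermonde's convolution: `W n f` weights `f w` by C(n,w), and the weight of a concatenation
  -- is the sum of the weights of its pieces.
  W-block : ∀ m n (f : ℕ → ℕ) → W (m + n) f ≡ W m (λ a → W n (λ b → f (a + b)))
  W-block zero    n f = refl
  W-block (suc m) n f = trans
    (W-block m n (λ w → f w + f (suc w)))
    (W-cong m (λ a → W-+ n (λ b → f (a + b)) (λ b → f (suc a + b))))

  ∑-popcount : ∀ n (f : ℕ → ℕ) → ∑ n (f ∘ popcount) ≡ W n f
  ∑-popcount zero    f = refl
  ∑-popcount (suc n) f = ∑-popcount n (λ w → f w + f (suc w))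

  -- Both halves are read off one vector by position. Since `2 * n` unfolds to `n + (n + 0)`, this
  -- applies without casts to the inputs of the theorem, whose second half has `n + 0` variables.
  wx : ∀ m {n} → Vec Bool (m + n) → ℕ
  wx zero    z           = 0
  wx (suc m) (false ∷ z) = wx m z
  wx (suc m) (true ∷ z)  = suc (wx m z)

  wy : ∀ m {n} → Vec Bool (m + n) → ℕ
  wy zero    z       = popcount z
  wy (suc m) (_ ∷ z) = wy m z

  wx+wy : ∀ m {n} (z : Vec Bool (m + n)) → wx m z + wy m z ≡ popcount z
  wx+wy zero    z           = refl
  wx+wy (suc m) (false ∷ z) = wx+wy m z
  wx+wy (suc m) (true ∷ z)  = cong suc (wx+wy m z)

  wx-++ : ∀ {m n} (x : Vec Bool m) (y : Vec Bool n) → wx m (x ++ y) ≡ popcount x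
  wx-++ []          y = refl
  wx-++ (false ∷ x) y = wx-++ x y
  wx-++ (true ∷ x)  y = cong suc (wx-++ x y)

  wy-++ : ∀ {m n} (x : Vec Bool m) (y : Vec Bool n) → wy m (x ++ y) ≡ popcount y
  wy-++ []      y = refl
  wy-++ (_ ∷ x) y = wy-++ x y

  ∑-weights : ∀ m n (f : ℕ → ℕ → ℕ) → ∑ (m + n) (λ z → f (wx m z) (wy m z)) ≡ W m (λ a → W n (f a))
  ∑-weights zero    n f = ∑-popcount n (f 0)
  ∑-weights (suc m) n f = trans
    (∑-weights m n (λ a b → f a b + f (suc a) b))
    (W-cong m (λ a → W-+ n (f a) (f (suc a))))

  -- Restrictions

  -- An order-preserving injection of m live variables into n variables.
  data Emb : ℕ → ℕ → Set where
    nil  : Emb 0 0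
    live : ∀ {m n} → Emb m n → Emb (suc m) (suc n)
    dead : ∀ {m n} → Emb m n → Emb m (suc n)

  none : ∀ n → Emb 0 n
  none zero    = nil
  none (suc n) = dead (none n)

  all : ∀ n → Emb n n
  all zero    = nil
  all (suc n) = live (all n)

  Emb-≤ : ∀ {m n} → m ≤ n → Emb m n
  Emb-≤ {n = n} z≤n       = none n
  Emb-≤         (s≤s m≤n) = live (Emb-≤ m≤n)

  _⨾_ : ∀ {l m n} → Emb l m → Emb m n → Emb l n
  D      ⨾ nil    = D
  live D ⨾ live E = live (D ⨾ E)
  dead D ⨾ live E = dead (D ⨾ E)
  D      ⨾ dead E = dead (D ⨾ E)

  _⊕_ : ∀ {m n m′ n′} → Emb m n → Emb m′ n′ → Emb (m + m′) (n + n′)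
  nil    ⊕ E = E
  live D ⊕ E = live (D ⊕ E)
  dead D ⊕ E = dead (D ⊕ E)

  embed : ∀ {m n} → Emb m n → Vec Bool m → Vec Bool n
  embed nil      S       = S
  embed (live E) (b ∷ S) = b ∷ embed E S
  embed (dead E) S       = false ∷ embed E S

  popcount-embed : ∀ {m n} (E : Emb m n) S → popcount (embed E S) ≡ popcount S
  popcount-embed nil      S           = refl
  popcount-embed (live E) (false ∷ S) = popcount-embed E S
  popcount-embed (live E) (true ∷ S)  = cong suc (popcount-embed E S)
  popcount-embed (dead E) S           = popcount-embed E S

  embed-⨾ : ∀ {l m n} (D : Emb l m) (E : Emb m n) S → embed (D ⨾ E) S ≡ embed E (embed D S)
  embed-⨾ D        nil      S       = refl
  embed-⨾ (live D) (live E) (b ∷ S) = cong (b ∷_) (embed-⨾ D E S)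
  embed-⨾ (dead D) (live E) S       = cong (false ∷_) (embed-⨾ D E S)
  embed-⨾ nil      (dead E) S       = cong (false ∷_) (embed-⨾ nil E S)
  embed-⨾ (live D) (dead E) S       = cong (false ∷_) (embed-⨾ (live D) E S)
  embed-⨾ (dead D) (dead E) S       = cong (false ∷_) (embed-⨾ (dead D) E S)

  embed-⊕ : ∀ {m n m′ n′} (D : Emb m n) (E : Emb m′ n′) S T → embed (D ⊕ E) (S ++ T) ≡ embed D S ++ embed E T
  embed-⊕ nil      E []      T = refl
  embed-⊕ (live D) E (b ∷ S) T = cong (b ∷_) (embed-⊕ D E S T)
  embed-⊕ (dead D) E S       T = cong (false ∷_) (embed-⊕ D E S T)

  -- The values of ρ at live positions are ignored.
  merge : ∀ {m n} → Emb m n → Vec Bool n → Vec Bool m → Vec Bool n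
  merge nil      ρ       z       = z
  merge (live E) (_ ∷ ρ) (b ∷ z) = b ∷ merge E ρ z
  merge (dead E) (a ∷ ρ) z       = a ∷ merge E ρ z

  deadweight : ∀ {m n} → Emb m n → Vec Bool n → ℕ
  deadweight nil      ρ           = 0
  deadweight (live E) (_ ∷ ρ)     = deadweight E ρ
  deadweight (dead E) (false ∷ ρ) = deadweight E ρ
  deadweight (dead E) (true ∷ ρ)  = suc (deadweight E ρ)

  popcount-merge : ∀ {m n} (E : Emb m n) ρ z → popcount (merge E ρ z) ≡ deadweight E ρ + popcount z
  popcount-merge nil      ρ           z           = refl
  popcount-merge (live E) (_ ∷ ρ)     (false ∷ z) = popcount-merge E ρ z
  popcount-merge (live E) (_ ∷ ρ)     (true ∷ z)  = trans (cong suc (popcount-merge E ρ z)) (sym (+-suc _ _))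
  popcount-merge (dead E) (false ∷ ρ) z           = popcount-merge E ρ z
  popcount-merge (dead E) (true ∷ ρ)  z           = cong suc (popcount-merge E ρ z)

  merge-⊕ : ∀ {m n m′ n′} (D : Emb m n) (E : Emb m′ n′) ρ σ x y →
            merge (D ⊕ E) (ρ ++ σ) (x ++ y) ≡ merge D ρ x ++ merge E σ y
  merge-⊕ nil      E []      σ []      y = refl
  merge-⊕ (live D) E (_ ∷ ρ) σ (b ∷ x) y = cong (b ∷_) (merge-⊕ D E ρ σ x y)
  merge-⊕ (dead D) E (a ∷ ρ) σ x       y = cong (a ∷_) (merge-⊕ D E ρ σ x y)

  weights-merge : ∀ {m n m′ n′} (D : Emb m n) (E : Emb m′ n′) (ρ : Vec Bool (n + n′)) → ∃₂ λ s t →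
    ∀ z → (wx n (merge (D ⊕ E) ρ z) ≡ s + wx m z) × (wy n (merge (D ⊕ E) ρ z) ≡ t + wy m z)
  weights-merge {m} {n} D E ρ with splitAt n ρ
  ... | ρx , ρy , refl = deadweight D ρx , deadweight E ρy , weights
    where
    weights : ∀ z → (wx n (merge (D ⊕ E) (ρx ++ ρy) z) ≡ deadweight D ρx + wx m z)
                  × (wy n (merge (D ⊕ E) (ρx ++ ρy) z) ≡ deadweight E ρy + wy m z)
    weights z with splitAt m z
    ... | x , y , refl
      rewrite merge-⊕ D E ρx ρy x y
            | wx-++ (merge D ρx x) (merge E ρy y) | wy-++ (merge D ρx x) (merge E ρy y)
            | wx-++ x y | wy-++ x y
      = popcount-merge D ρx x , popcount-merge E ρy y

  wx-embed : ∀ {m n m′ n′} (D : Emb m n) (E : Emb m′ n′) S → wx n (embed (D ⊕ E) S) ≡ wx m S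
  wx-embed nil      E S           = refl
  wx-embed (live D) E (false ∷ S) = wx-embed D E S
  wx-embed (live D) E (true ∷ S)  = cong suc (wx-embed D E S)
  wx-embed (dead D) E S           = wx-embed D E S

  -- The subcubes obtained by fixing the dead coordinates partition the cube, so a lower bound p/q
  -- for the mean of `f` on each of them is one for the mean on the whole cube.
  ∑-restrict : ∀ {m n} (E : Emb m n) p q (f : Vec Bool n → ℕ) →
               (∀ ρ → p * 2 ^ m ≤ q * ∑ m (f ∘ merge E ρ)) → p * 2 ^ n ≤ q * ∑ n f
  ∑-restrict nil p q f h = h []
  -- The two halves are summed into one function, which doubles `p`. The entry `false` given to `h`
  -- is arbitrary, as `merge` discards it.
  ∑-restrict {suc m} {suc n} (live E) p q f h = subst (_≤ q * ∑ (suc n) f) (*-assoc p 2 (2 ^ n))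
    (∑-restrict E (p * 2) q (λ v → f (false ∷ v) + f (true ∷ v))
      (λ ρ → subst (_≤ q * ∑ m (λ z → f (false ∷ merge E ρ z) + f (true ∷ merge E ρ z)))
               (sym (*-assoc p 2 (2 ^ m))) (h (false ∷ ρ))))
  ∑-restrict {m} {suc n} (dead E) p q f h = begin
    p * 2 ^ suc n                                              ≡⟨ double p (2 ^ n) ⟩
    p * 2 ^ n + p * 2 ^ n                                      ≤⟨ +-mono-≤ (ih false) (ih true) ⟩
    q * ∑ n (f ∘ (false ∷_)) + q * ∑ n (f ∘ (true ∷_))         ≡⟨ *-distribˡ-+ q _ _ ⟨
    q * (∑ n (f ∘ (false ∷_)) + ∑ n (f ∘ (true ∷_)))           ≡⟨ cong (q *_) (∑-+ n _ _) ⟨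
    q * ∑ (suc n) f                                            ∎
    where
    open ≤-Reasoning
    double : ∀ p t → p * (t + (t + 0)) ≡ p * t + p * t
    double = solve-∀
    ih : ∀ b → p * 2 ^ n ≤ q * ∑ n (f ∘ (b ∷_))
    ih b = ∑-restrict E p q (f ∘ (b ∷_)) (λ ρ → h (b ∷ ρ))

  -- Multilinear polynomials over 𝔽₂, given by their coefficients

  ev : ∀ {n} → (Vec Bool n → Bool) → Vec Bool n → Bool
  ev c []          = c []
  ev c (false ∷ x) = ev (c ∘ (false ∷_)) x
  ev c (true ∷ x)  = ev (c ∘ (false ∷_)) x xor ev (c ∘ (true ∷_)) x

  xor-interchange : ∀ a b c d → (a xor b) xor (c xor d) ≡ (a xor c) xor (b xor d)
  xor-interchange false b false d = refl
  xor-interchange false b true  d = sym (𝔹.not-distribʳ-xor b d)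
  xor-interchange true  b false d = sym (𝔹.not-distribˡ-xor b d)
  xor-interchange true  b true  d = 𝔹.xor-annihilates-not b d

  ev-cong : ∀ {n} {c c′ : Vec Bool n → Bool} → (∀ S → c S ≡ c′ S) → ∀ x → ev c x ≡ ev c′ x
  ev-cong c≗c′ []          = c≗c′ []
  ev-cong c≗c′ (false ∷ x) = ev-cong (c≗c′ ∘ (false ∷_)) x
  ev-cong c≗c′ (true ∷ x)  = cong₂ _xor_ (ev-cong (c≗c′ ∘ (false ∷_)) x) (ev-cong (c≗c′ ∘ (true ∷_)) x)

  ev-xor : ∀ {n} (c c′ : Vec Bool n → Bool) x → ev (λ S → c S xor c′ S) x ≡ ev c x xor ev c′ x
  ev-xor c c′ []          = refl
  ev-xor c c′ (false ∷ x) = ev-xor (c ∘ (false ∷_)) (c′ ∘ (false ∷_)) x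
  ev-xor c c′ (true ∷ x)  = trans
    (cong₂ _xor_ (ev-xor (c ∘ (false ∷_)) (c′ ∘ (false ∷_)) x) (ev-xor (c ∘ (true ∷_)) (c′ ∘ (true ∷_)) x))
    (xor-interchange (ev (c ∘ (false ∷_)) x) _ _ _)

  ev-zero : ∀ {n} (x : Vec Bool n) → ev (λ _ → false) x ≡ false
  ev-zero []          = refl
  ev-zero (false ∷ x) = ev-zero x
  ev-zero (true ∷ x)  = cong₂ _xor_ (ev-zero x) (ev-zero x)

  ev-∧ : ∀ {n} b (c : Vec Bool n → Bool) x → ev (λ S → b ∧ c S) x ≡ b ∧ ev c x
  ev-∧ false c x = ev-zero x
  ev-∧ true  c x = refl

  -- Setting a variable to 1 identifies each monomial containing it with the one lacking it, so
  -- their coefficients add; setting it to 0 drops the former.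
  res : ∀ {m n} → Emb m n → Vec Bool n → (Vec Bool n → Bool) → Vec Bool m → Bool
  res nil      ρ           c S       = c S
  res (live E) (_ ∷ ρ)     c (b ∷ S) = res E ρ (c ∘ (b ∷_)) S
  res (dead E) (false ∷ ρ) c S       = res E ρ (c ∘ (false ∷_)) S
  res (dead E) (true ∷ ρ)  c S       = res E ρ (λ S′ → c (false ∷ S′) xor c (true ∷ S′)) S

  ev-res : ∀ {m n} (E : Emb m n) ρ c z → ev (res E ρ c) z ≡ ev c (merge E ρ z)
  ev-res nil      ρ           c z           = refl
  ev-res (live E) (_ ∷ ρ)     c (false ∷ z) = ev-res E ρ (c ∘ (false ∷_)) z
  ev-res (live E) (_ ∷ ρ)     c (true ∷ z)  = cong₂ _xor_ (ev-res E ρ (c ∘ (false ∷_)) z) (ev-res E ρ (c ∘ (true ∷_)) z)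
  ev-res (dead E) (false ∷ ρ) c z           = ev-res E ρ (c ∘ (false ∷_)) z
  ev-res (dead E) (true ∷ ρ)  c z           = trans
    (ev-res E ρ (λ S → c (false ∷ S) xor c (true ∷ S)) z)
    (ev-xor (c ∘ (false ∷_)) (c ∘ (true ∷_)) (merge E ρ z))

  -- Fixing variables changes a coefficient only by coefficients of larger monomials.
  res-top : ∀ {m n} (E : Emb m n) ρ c S → (∀ S′ → popcount S < popcount S′ → c S′ ≡ false) →
            res E ρ c S ≡ c (embed E S)
  res-top nil      ρ           c S           top = refl
  res-top (live E) (_ ∷ ρ)     c (false ∷ S) top = res-top E ρ (c ∘ (false ∷_)) S (top ∘ (false ∷_))
  res-top (live E) (_ ∷ ρ)     c (true ∷ S)  top = res-top E ρ (c ∘ (true ∷_)) S (λ S′ → top (true ∷ S′) ∘ s≤s)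
  res-top (dead E) (false ∷ ρ) c S           top = res-top E ρ (c ∘ (false ∷_)) S (top ∘ (false ∷_))
  res-top (dead E) (true ∷ ρ)  c S           top = trans
    (res-top E ρ (λ S′ → c (false ∷ S′) xor c (true ∷ S′)) S
      (λ S′ lt → cong₂ _xor_ (top (false ∷ S′) lt) (top (true ∷ S′) (m<n⇒m<1+n lt))))
    (trans (cong (c (false ∷ embed E S) xor_) (top (true ∷ embed E S) (s≤s (≤-reflexive (sym (popcount-embed E S))))))
           (xor-identityʳ _))

  -- Ramsey's theorem

  Homogeneous : ∀ {m n} → ℕ → (Vec Bool n → Bool) → Emb m n → Bool → Set
  Homogeneous k c E b = ∀ S → popcount S ≡ k → c (embed E S) ≡ b

  popcount-0 : ∀ {n} (S T : Vec Bool n) → popcount S ≡ 0 → popcount T ≡ 0 → S ≡ T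
  popcount-0 []          []          _ _ = refl
  popcount-0 (false ∷ S) (false ∷ T) p q = cong (false ∷_) (popcount-0 S T p q)

  Homogeneous-⨾ : ∀ {l m n k} (c : Vec Bool n → Bool) {b} (D : Emb l m) (E : Emb m n) →
                  Homogeneous k c E b → Homogeneous k c (D ⨾ E) b
  Homogeneous-⨾ c D E h S p = trans (cong c (embed-⨾ D E S)) (h (embed D S) (trans (popcount-embed D S) p))

  Ramsey : ℕ → ℕ → ℕ → Set
  Ramsey k m R = ∀ (c : Vec Bool R → Bool) → ∃₂ λ (E : Emb m R) b → Homogeneous k c E b

  -- The two colours have separate target sizes because one inductive step lowers only one of them.
  Ramsey₂ : ℕ → ℕ → ℕ → ℕ → Set
  Ramsey₂ k p q R = ∀ (c : Vec Bool R → Bool) →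
    (∃ λ (E : Emb p R) → Homogeneous k c E false) ⊎ (∃ λ (E : Emb q R) → Homogeneous k c E true)

  -- The first variable colours the `k`-sets of the others through its link. On a set where the link
  -- has one colour, the first variable can be added to any homogeneous set of that colour, and is
  -- left out otherwise. The maximum of `R₁` and `R₂` leaves enough room for either colour of the
  -- link.
  ramsey₂-step : ∀ {k p q R₁ R₂ L} → Ramsey₂ (suc k) p (suc q) R₁ → Ramsey₂ (suc k) (suc p) q R₂ →
                 Ramsey k (R₁ ⊔ R₂) L → Ramsey₂ (suc k) (suc p) (suc q) (suc L)
  ramsey₂-step {k} {p} {q} {R₁} {R₂} {L} ram₁ ram₂ ram c with ram (c ∘ (true ∷_))
  ... | E , b , link = step b link
    where
    E₁ : Emb R₁ L
    E₁ = Emb-≤ (m≤m⊔n R₁ R₂) ⨾ E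
    E₂ : Emb R₂ L
    E₂ = Emb-≤ (m≤n⊔m R₁ R₂) ⨾ E

    avoid : ∀ {m R b} {D : Emb m R} (E′ : Emb R L) → Homogeneous (suc k) (c ∘ (false ∷_) ∘ embed E′) D b →
            Homogeneous (suc k) c (dead (D ⨾ E′)) b
    avoid {D = D} E′ h S eq = trans (cong (c ∘ (false ∷_)) (embed-⨾ D E′ S)) (h S eq)

    include : ∀ {m R b} {D : Emb m R} (E′ : Emb R L) → Homogeneous k (c ∘ (true ∷_)) E′ b →
              Homogeneous (suc k) (c ∘ (false ∷_) ∘ embed E′) D b → Homogeneous (suc k) c (live (D ⨾ E′)) b
    include         E′ l h (false ∷ S) eq = avoid E′ h S eq
    include {D = D} E′ l h (true ∷ S)  eq = Homogeneous-⨾ (c ∘ (true ∷_)) D E′ l S (suc-injective eq)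

    step : ∀ b → Homogeneous k (c ∘ (true ∷_)) E b →
           (∃ λ (E : Emb (suc p) (suc L)) → Homogeneous (suc k) c E false) ⊎
           (∃ λ (E : Emb (suc q) (suc L)) → Homogeneous (suc k) c E true)
    step false l with ram₁ (c ∘ (false ∷_) ∘ embed E₁)
    ... | inj₁ (D , h) = inj₁ (live (D ⨾ E₁) , include E₁ (Homogeneous-⨾ (c ∘ (true ∷_)) (Emb-≤ (m≤m⊔n R₁ R₂)) E l) h)
    ... | inj₂ (D , h) = inj₂ (dead (D ⨾ E₁) , avoid E₁ h)
    step true l with ram₂ (c ∘ (false ∷_) ∘ embed E₂)
    ... | inj₁ (D , h) = inj₁ (dead (D ⨾ E₂) , avoid E₂ h)
    ... | inj₂ (D , h) = inj₂ (live (D ⨾ E₂) , include E₂ (Homogeneous-⨾ (c ∘ (true ∷_)) (Emb-≤ (m≤n⊔m R₁ R₂)) E l) h)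

  ramsey  : ∀ k m → ∃ λ R → Ramsey k m R
  ramsey₂ : ∀ k p q → ∃ λ R → Ramsey₂ (suc k) p q R

  ramsey zero m = m , λ c → all m , c (embed (all m) (zeros m)) ,
    λ S eq → cong (c ∘ embed (all m)) (popcount-0 S (zeros m) eq (popcount-zeros m))
    where
    zeros : ∀ n → Vec Bool n
    zeros zero    = []
    zeros (suc n) = false ∷ zeros n
    popcount-zeros : ∀ n → popcount (zeros n) ≡ 0
    popcount-zeros zero    = refl
    popcount-zeros (suc n) = popcount-zeros n
  ramsey (suc k) m with ramsey₂ k m m
  ... | R , ram = R , λ c → homogeneous c (ram c)
    where
    homogeneous : ∀ c → (∃ λ (E : Emb m R) → Homogeneous (suc k) c E false) ⊎
                          (∃ λ (E : Emb m R) → Homogeneous (suc k) c E true) →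
                  ∃₂ λ (E : Emb m R) b → Homogeneous (suc k) c E b
    homogeneous c (inj₁ (E , h)) = E , false , h
    homogeneous c (inj₂ (E , h)) = E , true , h

  ramsey₂ k zero    q       = 0 , λ c → inj₁ (nil , λ { [] () })
  ramsey₂ k (suc p) zero    = 0 , λ c → inj₂ (nil , λ { [] () })
  ramsey₂ k (suc p) (suc q) =
    let R₁ , ram₁ = ramsey₂ k p (suc q)
        R₂ , ram₂ = ramsey₂ k (suc p) q
        L  , ram  = ramsey k (R₁ ⊔ R₂)
    in suc L , ramsey₂-step ram₁ ram₂ ram

  -- The colourings are treated one after another, each inside the set found for its predecessors,
  -- because homogeneity passes to subsets. The common colour may differ from one `T` to another.
  ramsey-family : ∀ r k m → ∃ λ R → ∀ (c : Vec Bool r → Vec Bool R → Bool) →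
                  ∃ λ (E : Emb m R) → ∀ T → ∃ λ b → Homogeneous k (c T) E b
  ramsey-family zero k m with ramsey k m
  ... | R , ram = R , λ c → let E , b , h = ram (c []) in E , λ { [] → b , h }
  ramsey-family (suc r) k m =
    let R₁ , ram₁ = ramsey-family r k m
        R₂ , ram₂ = ramsey-family r k R₁
    in R₂ , λ c →
      let E , h = ram₂ (c ∘ (false ∷_))
          D , g = ram₁ (λ T S → c (true ∷ T) (embed E S))
      in D ⨾ E , λ
        { (false ∷ T) → proj₁ (h T) , Homogeneous-⨾ (c (false ∷ T)) D E (proj₂ (h T))
        ; (true ∷ T)  → proj₁ (g T) , λ S eq → trans (cong (c (true ∷ T)) (embed-⨾ D E S)) (proj₂ (g T) S eq) }

  -- `N` is chosen before `M`: each of the `2 ^ N` sets `T` of y-variables gives a colouring of the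
  -- x-sets, and all of these must become homogeneous together. The resulting colour is then a
  -- colouring of the sets `T` alone.
  ramsey-bipartite : ∀ i j m n → ∃₂ λ M N → ∀ (c : Vec Bool (M + N) → Bool) →
    ∃₂ λ (D : Emb m M) (E : Emb n N) → ∃ λ b →
    ∀ S → wx m S ≡ i → wy m S ≡ j → c (embed (D ⊕ E) S) ≡ b
  ramsey-bipartite i j m n =
    let N , ramY = ramsey j n
        M , ramX = ramsey-family N i m
    in M , N , λ c →
      let D , h = ramX (λ T S → c (S ++ T))
          E , b , g = ramY (λ T → proj₁ (h T))
      in D , E , b , homogeneous c D E h b g
    where
    homogeneous : ∀ {M N} (c : Vec Bool (M + N) → Bool) (D : Emb m M) (E : Emb n N)
      (h : ∀ T → ∃ λ b → Homogeneous i (λ S → c (S ++ T)) D b) b →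
      Homogeneous j (λ T → proj₁ (h T)) E b → ∀ S → wx m S ≡ i → wy m S ≡ j → c (embed (D ⊕ E) S) ≡ b
    homogeneous c D E h b g S p q with splitAt m S
    ... | x , y , refl = trans (cong c (embed-⊕ D E x y))
      (trans (proj₂ (h (embed E y)) x (trans (sym (wx-++ x y)) p)) (g y (trans (sym (wy-++ x y)) q)))

  -- Equidistribution of weights along a d-grid

  W-bottom : ∀ n (f : ℕ → ℕ) → f 0 ≤ W n f
  W-bottom zero    f = ≤-refl
  W-bottom (suc n) f = ≤-trans (m≤m+n (f 0) (f 1)) (W-bottom n _)

  W-top : ∀ n (f : ℕ → ℕ) → f n ≤ W n f
  W-top zero    f = ≤-refl
  W-top (suc n) f = ≤-trans (m≤n+m (f (suc n)) (f n)) (W-top n _)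

  W-ends : ∀ n (f : ℕ → ℕ) → 1 ≤ n → f 0 + f n ≤ W n f
  W-ends (suc n) f _ = ≤-trans (+-mono-≤ (W-bottom n f) (W-top n (f ∘ suc))) (≤-reflexive (sym (W-+ n f (f ∘ suc))))

  sum₄ : ℕ → (ℕ → ℕ) → ℕ
  sum₄ d f = f 0 + (f (1 * d) + (f (2 * d) + f (3 * d)))

  sum₄-cong : ∀ d {f g : ℕ → ℕ} → (∀ a → f a ≡ g a) → sum₄ d f ≡ sum₄ d g
  sum₄-cong d f≗g = cong₂ _+_ (f≗g 0) (cong₂ _+_ (f≗g _) (cong₂ _+_ (f≗g _) (f≗g _)))

  sum₄-mono : ∀ d {f g : ℕ → ℕ} → (∀ a → f a ≤ g a) → sum₄ d f ≤ sum₄ d g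
  sum₄-mono d f≤g = +-mono-≤ (f≤g 0) (+-mono-≤ (f≤g _) (+-mono-≤ (f≤g _) (f≤g _)))

  sum₄-W : ∀ d n (f : ℕ → ℕ → ℕ) → sum₄ d (λ a → W n (f a)) ≡ W n (λ w → sum₄ d (λ a → f a w))
  sum₄-W d n f = sym (trans (W-+ n _ _) (cong (W n (f 0) +_) (trans (W-+ n _ _) (cong (W n (f (1 * d)) +_) (W-+ n _ _)))))

  sum₄-affine : ∀ d k (f : ℕ → ℕ) c → sum₄ d (λ a → k * f a + c) ≡ k * sum₄ d f + 4 * c
  sum₄-affine d k f c = identity k (f 0) (f (1 * d)) (f (2 * d)) (f (3 * d)) c
    where
    identity : ∀ k p q r s c → (k * p + c) + ((k * q + c) + ((k * r + c) + (k * s + c))) ≡ k * (p + (q + (r + s))) + 4 * c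
    identity = solve-∀

  -- The four terms belong to the words made of 0, 1, 2 or 3 blocks of `d` ones followed by zeros.
  -- These are distinct because `d` is positive.
  sum₄≤W : ∀ d (f : ℕ → ℕ) → 1 ≤ d → sum₄ d f ≤ W (3 * d) f
  sum₄≤W d f 1≤d = ≤-trans (+-monoʳ-≤ (f 0) (≤-trans (+-monoʳ-≤ (f (1 * d)) (first 0 (λ w → f (d + (d + w))))) (first (1 * d) (λ w → f (d + w))))) (first (2 * d) f)
    where
    first : ∀ n (g : ℕ → ℕ) → g 0 + W n (λ w → g (d + w)) ≤ W (d + n) g
    first n g = begin
      g 0 + W n (λ w → g (d + w))     ≤⟨ +-monoˡ-≤ _ (W-bottom n g) ⟩
      W n g + W n (λ w → g (d + w))   ≤⟨ W-ends d (λ a → W n (λ w → g (a + w))) 1≤d ⟩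
      W d (λ a → W n (λ w → g (a + w))) ≡⟨ W-block d n g ⟨
      W (d + n) g ∎
      where open ≤-Reasoning

  WW : ℕ → ℕ → (ℕ → ℕ → ℕ) → ℕ
  WW m n f = W m (λ a → W n (f a))

  WW-mono : ∀ m n {f g : ℕ → ℕ → ℕ} → (∀ a b → f a b ≤ g a b) → WW m n f ≤ WW m n g
  WW-mono m n f≤g = W-mono m (λ a → W-mono n (f≤g a))

  WW-cong : ∀ m n {f g : ℕ → ℕ → ℕ} → (∀ a b → f a b ≡ g a b) → WW m n f ≡ WW m n g
  WW-cong m n f≗g = W-cong m (λ a → W-cong n (f≗g a))

  WW-const : ∀ m n c → WW m n (λ _ _ → c) ≡ 2 ^ m * 2 ^ n * c
  WW-const m n c = trans (W-cong m (λ _ → W-const n c)) (trans (W-const m _) (sym (*-assoc (2 ^ m) (2 ^ n) c)))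

  WW-affine : ∀ m n k (f : ℕ → ℕ → ℕ) c → WW m n (λ a b → k * f a b + c) ≡ k * WW m n f + 2 ^ m * 2 ^ n * c
  WW-affine m n k f c = begin
    WW m n (λ a b → k * f a b + c)                      ≡⟨ W-cong m (λ a → W-+ n (λ b → k * f a b) (λ _ → c)) ⟩
    W m (λ a → W n (λ b → k * f a b) + W n (λ _ → c))   ≡⟨ W-+ m _ _ ⟩
    WW m n (λ a b → k * f a b) + WW m n (λ _ _ → c)     ≡⟨ cong₂ _+_ (trans (W-cong m (λ a → W-* n k (f a))) (W-* m k _)) (WW-const m n c) ⟩
    k * WW m n f + 2 ^ m * 2 ^ n * c                    ∎
    where open ≡-Reasoning

  WW-block : ∀ k m n (f : ℕ → ℕ → ℕ) →
             WW (k + m) (k + n) f ≡ WW k k (λ a b → WW m n (λ w v → f (a + w) (b + v)))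
  WW-block k m n f = trans (W-block k m _) (W-cong k (λ a →
    trans (W-cong m (λ w → W-block k n (f (a + w)))) (W-swap m k _)))

  grid : ℕ → (ℕ → ℕ → ℕ) → ℕ
  grid d f = sum₄ d (λ a → sum₄ d (f a))

  grid-cong : ∀ d {f g : ℕ → ℕ → ℕ} → (∀ a b → f a b ≡ g a b) → grid d f ≡ grid d g
  grid-cong d f≗g = sum₄-cong d (λ a → sum₄-cong d (f≗g a))

  grid-affine : ∀ d k (f : ℕ → ℕ → ℕ) c → grid d (λ a b → k * f a b + c) ≡ k * grid d f + 16 * c
  grid-affine d k f c = trans (sum₄-cong d (λ a → sum₄-affine d k (f a) c))
    (trans (sum₄-affine d k (λ a → sum₄ d (f a)) (4 * c)) (cong (k * grid d f +_) (sym (*-assoc 4 4 c))))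

  grid-WW : ∀ d m n (f : ℕ → ℕ → ℕ → ℕ → ℕ) →
            grid d (λ a b → WW m n (f a b)) ≡ WW m n (λ w v → grid d (λ a b → f a b w v))
  grid-WW d m n f = trans
    (sum₄-cong d (λ a → trans (sum₄-W d m (λ b w → W n (f a b w))) (W-cong m (λ w → sum₄-W d n (λ b → f a b w)))))
    (trans (sum₄-W d m (λ a w → W n (λ v → sum₄ d (λ b → f a b w v))))
           (W-cong m (λ w → sum₄-W d n (λ a v → sum₄ d (λ b → f a b w v)))))

  grid≤WW : ∀ d f → 1 ≤ d → grid d f ≤ WW (3 * d) (3 * d) f
  grid≤WW d f 1≤d = ≤-trans (sum₄-mono d (λ a → sum₄≤W d (f a) 1≤d)) (sum₄≤W d _ 1≤d)

  -- The 16 grid points are weights of distinct words, and the other words contribute at least L each.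
  grid-excess : ∀ d (f : ℕ → ℕ → ℕ) L → 1 ≤ d → (∀ a b → L ≤ f a b) →
                grid d f + 2 ^ (3 * d) * 2 ^ (3 * d) * L ≤ WW (3 * d) (3 * d) f + 16 * L
  grid-excess d f L 1≤d L≤f = begin
    grid d f + Q * L                     ≡⟨ cong (_+ Q * L) (grid-cong d split) ⟩
    grid d (λ a b → 1 * g a b + L) + Q * L ≡⟨ cong (_+ Q * L) (grid-affine d 1 g L) ⟩
    (1 * grid d g + 16 * L) + Q * L      ≤⟨ +-monoˡ-≤ (Q * L) (+-monoˡ-≤ (16 * L) (*-monoʳ-≤ 1 (grid≤WW d g 1≤d))) ⟩
    (1 * WW k k g + 16 * L) + Q * L      ≡⟨ exchange (1 * WW k k g) (16 * L) (Q * L) ⟩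
    (1 * WW k k g + Q * L) + 16 * L      ≡⟨ cong (_+ 16 * L) (WW-affine k k 1 g L) ⟨
    WW k k (λ a b → 1 * g a b + L) + 16 * L ≡⟨ cong (_+ 16 * L) (WW-cong k k split) ⟨
    WW k k f + 16 * L                    ∎
    where
    open ≤-Reasoning
    k = 3 * d
    Q = 2 ^ k * 2 ^ k
    g : ℕ → ℕ → ℕ
    g a b = f a b ∸ L
    split : ∀ a b → f a b ≡ 1 * g a b + L
    split a b = sym (trans (cong (_+ L) (*-identityˡ (g a b))) (m∸n+n≡m (L≤f a b)))
    exchange : ∀ p q r → (p + q) + r ≡ (p + r) + q
    exchange = solve-∀

  shift : ∀ {A : Set} → ℕ → ℕ → (ℕ → ℕ → A) → ℕ → ℕ → A
  shift s t f w v = f (s + w) (t + v)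

  GridBound : ℕ → ℕ → (ℕ → ℕ → ℕ) → Set
  GridBound d C f = ∀ w v → C ≤ grid d (λ a b → f (a + w) (b + v))

  +-left-comm : ∀ a b c → a + (b + c) ≡ b + (a + c)
  +-left-comm = solve-∀

  GridBound-shift : ∀ {d C} s t {f : ℕ → ℕ → ℕ} → GridBound d C f → GridBound d C (shift s t f)
  GridBound-shift {d} {C} s t {f} bound w v = subst (C ≤_)
    (grid-cong d (λ a b → cong₂ f (+-left-comm a s w) (+-left-comm b t v)))
    (bound (s + w) (t + v))

  power-square : ∀ k {q} → 2 ^ k * 2 ^ k ≡ q → ∀ m → 2 ^ (m * k) * 2 ^ (m * k) ≡ q ^ m
  power-square k     size zero    = refl
  power-square k {q} size (suc m) = begin
    2 ^ (k + m * k) * 2 ^ (k + m * k)             ≡⟨ cong₂ _*_ (^-distribˡ-+-* 2 k (m * k)) (^-distribˡ-+-* 2 k (m * k)) ⟩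
    (2 ^ k * 2 ^ (m * k)) * (2 ^ k * 2 ^ (m * k)) ≡⟨ [m*n]*[o*p]≡[m*o]*[n*p] (2 ^ k) _ _ _ ⟩
    (2 ^ k * 2 ^ k) * (2 ^ (m * k) * 2 ^ (m * k)) ≡⟨ cong₂ _*_ size (power-square k size m) ⟩
    q * q ^ m                                     ∎
    where open ≡-Reasoning

  -- Split one block of `3 * d` variables off each half. Of its `a + 16` words, 16 represent the
  -- grid, and over these together the hypothesis gives the full mean C/16. Each of the other `a`
  -- words has by induction a deficit of at most `C * a ^ m`, so each block multiplies the relative
  -- deficit by a/(a + 16). Both sides are enlarged before comparison to keep subtraction out of ℕ.
  equidistribution-rate : ∀ d C a → 1 ≤ d → 2 ^ (3 * d) * 2 ^ (3 * d) ≡ a + 16 → ∀ m f → GridBound d C f →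
    C * (a + 16) ^ m ≤ 16 * WW (m * (3 * d)) (m * (3 * d)) f + C * a ^ m
  equidistribution-rate d C a 1≤d size zero    f bound = m≤n+m (C * 1) _
  equidistribution-rate d C a 1≤d size (suc m) f bound = +-cancelˡ-≤ (16 * c + 16 * L) _ _ (begin
    (16 * c + 16 * L) + C * ((a + 16) * (a + 16) ^ m)
      ≡⟨ rearrange C a ((a + 16) ^ m) c ⟩
    16 * (L + c) + (a + 16) * L
      ≤⟨ +-monoˡ-≤ ((a + 16) * L) (*-monoʳ-≤ 16 (+-monoˡ-≤ c average)) ⟩
    16 * (grid d φ + c) + (a + 16) * L
      ≡⟨ cong (_+ (a + 16) * L) (trans (*-distribˡ-+ 16 (grid d φ) c) (sym (grid-affine d 16 φ c))) ⟩
    grid d Φ + (a + 16) * L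
      ≡⟨ cong (λ q → grid d Φ + q * L) size ⟨
    grid d Φ + 2 ^ k * 2 ^ k * L
      ≤⟨ grid-excess d Φ L 1≤d (λ p q → equidistribution-rate d C a 1≤d size m (shift p q f) (GridBound-shift {d} p q {f} bound)) ⟩
    WW k k Φ + 16 * L
      ≡⟨ cong (_+ 16 * L) (WW-affine k k 16 φ c) ⟩
    (16 * WW k k φ + 2 ^ k * 2 ^ k * c) + 16 * L
      ≡⟨ cong₂ (λ x q → (16 * x + q * c) + 16 * L) (sym (WW-block k (m * k) (m * k) f)) size ⟩
    (16 * V + (a + 16) * c) + 16 * L
      ≡⟨ rearrange′ C a V (a ^ m) (16 * L) ⟩
    (16 * c + 16 * L) + (16 * V + C * (a * a ^ m)) ∎)
    where
    open ≤-Reasoning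
    k = 3 * d
    L = C * (a + 16) ^ m
    c = C * a ^ m
    V = WW (suc m * k) (suc m * k) f
    φ Φ : ℕ → ℕ → ℕ
    φ p q = WW (m * k) (m * k) (shift p q f)
    Φ p q = 16 * φ p q + c
    average : L ≤ grid d φ
    average = begin
      C * (a + 16) ^ m                                   ≡⟨ *-comm C _ ⟩
      (a + 16) ^ m * C                                   ≡⟨ cong (_* C) (power-square k size m) ⟨
      2 ^ (m * k) * 2 ^ (m * k) * C                      ≡⟨ WW-const (m * k) (m * k) C ⟨
      WW (m * k) (m * k) (λ _ _ → C)                     ≤⟨ WW-mono (m * k) (m * k) bound ⟩
      WW (m * k) (m * k) (λ w v → grid d (λ p q → f (p + w) (q + v))) ≡⟨ grid-WW d (m * k) (m * k) (λ p q → shift p q f) ⟨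
      grid d φ                                           ∎
    rearrange : ∀ C a X y → (16 * y + 16 * (C * X)) + C * ((a + 16) * X) ≡ 16 * (C * X + y) + (a + 16) * (C * X)
    rearrange = solve-∀
    rearrange′ : ∀ C a V X y → (16 * V + (a + 16) * (C * X)) + y ≡ (16 * (C * X) + y) + (16 * V + C * (a * X))
    rearrange′ = solve-∀

  -- Bernoulli's inequality in the form (1 + 16/A)^m ≥ 1 + m/A, where A = a + 1. The exponent
  -- `e * A` makes the right side at least `e`.
  decay : ∀ a e → ∃ λ m → e * suc a ^ m ≤ (suc a + 16) ^ m
  decay a e = e * A , *-cancelˡ-≤ A (begin
    A * (e * A ^ (e * A))     ≡⟨ swap A e (A ^ (e * A)) ⟩
    e * A * A ^ (e * A)       ≤⟨ *-monoˡ-≤ (A ^ (e * A)) (m≤n+m (e * A) A) ⟩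
    (A + e * A) * A ^ (e * A) ≤⟨ bernoulli (e * A) ⟩
    A * (A + 16) ^ (e * A)    ∎)
    where
    open ≤-Reasoning
    A = suc a
    swap : ∀ x y z → x * (y * z) ≡ y * x * z
    swap = solve-∀
    expand : ∀ x m y → (x + suc m) * (x * y) + (15 * x + 16 * m) * y ≡ (x + 16) * ((x + m) * y)
    expand = solve-∀
    commute : ∀ x y z → x * (y * z) ≡ y * (x * z)
    commute = solve-∀
    bernoulli : ∀ m → (A + m) * A ^ m ≤ A * (A + 16) ^ m
    bernoulli zero    = ≤-reflexive (cong (_* 1) (+-identityʳ A))
    bernoulli (suc m) = begin
      (A + suc m) * (A * A ^ m)                                ≤⟨ m≤m+n _ _ ⟩
      (A + suc m) * (A * A ^ m) + (15 * A + 16 * m) * A ^ m    ≡⟨ expand A m (A ^ m) ⟩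
      (A + 16) * ((A + m) * A ^ m)                             ≤⟨ *-monoʳ-≤ (A + 16) (bernoulli m) ⟩
      (A + 16) * (A * (A + 16) ^ m)                            ≡⟨ commute (A + 16) A _ ⟩
      A * ((A + 16) * (A + 16) ^ m)                            ∎

  -- In terms of means: `f` averages at least C/16 - 1/e. The number `m` is chosen before `f`, as
  -- needed for targets that are only known after the rounds of absorption.
  equidistribution : ∀ d C e → 1 ≤ d → C ≤ 16 → ∃ λ m → ∀ f → GridBound d C f →
    (C * e ∸ 16) * 2 ^ (m + m) ≤ 16 * e * ∑ (m + m) (λ z → f (wx m z) (wy m z))
  equidistribution d C e 1≤d C≤16 = n , estimate
    where
    open ≤-Reasoning
    k = 3 * d
    Q = 2 ^ k * 2 ^ k
    17≤Q : 17 ≤ Q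
    17≤Q = ≤-trans (m≤m+n 17 47) (*-mono-≤ 8≤2^k 8≤2^k)
      where
      8≤2^k : 8 ≤ 2 ^ k
      8≤2^k = ^-monoʳ-≤ 2 (*-monoʳ-≤ 3 1≤d)
    -- `decay` has a positive base `suc a`, which is to be Q - 16; this is possible as Q is at least
    -- 8 · 8.
    a = Q ∸ 17
    size : Q ≡ suc a + 16
    size = trans (sym (m∸n+n≡m 17≤Q)) (+-suc a 16)
    m = proj₁ (decay a e)
    n = m * k
    estimate : ∀ f → GridBound d C f →
      (C * e ∸ 16) * 2 ^ (n + n) ≤ 16 * e * ∑ (n + n) (λ z → f (wx n z) (wy n z))
    estimate f bound = begin
      (C * e ∸ 16) * P         ≡⟨ *-distribʳ-∸ P (C * e) 16 ⟩
      C * e * P ∸ 16 * P       ≤⟨ m≤n+o⇒m∸n≤o (C * e * P) (16 * P) main ⟩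
      16 * e * S               ∎
      where
      P = 2 ^ (n + n)
      S = ∑ (n + n) (λ z → f (wx n z) (wy n z))
      P≡ : P ≡ (suc a + 16) ^ m
      P≡ = trans (^-distribˡ-+-* 2 n n) (power-square k size m)
      regroup : ∀ C e P → C * e * P ≡ e * (C * P)
      regroup = solve-∀
      regroup′ : ∀ e S C X → e * (16 * S + C * X) ≡ C * (e * X) + 16 * e * S
      regroup′ = solve-∀
      main : C * e * P ≤ 16 * P + 16 * e * S
      main = begin
        C * e * P                                ≡⟨ regroup C e P ⟩
        e * (C * P)                              ≡⟨ cong (λ x → e * (C * x)) P≡ ⟩
        e * (C * (suc a + 16) ^ m)               ≤⟨ *-monoʳ-≤ e (equidistribution-rate d C (suc a) 1≤d size m f bound) ⟩
        e * (16 * WW n n f + C * suc a ^ m)      ≡⟨ cong (λ x → e * (16 * x + C * suc a ^ m)) (∑-weights n n f) ⟨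
        e * (16 * S + C * suc a ^ m)             ≡⟨ regroup′ e S C (suc a ^ m) ⟩
        C * (e * suc a ^ m) + 16 * e * S         ≤⟨ +-monoˡ-≤ (16 * e * S) (*-mono-≤ C≤16 (proj₂ (decay a e))) ⟩
        16 * (suc a + 16) ^ m + 16 * e * S       ≡⟨ cong (λ x → 16 * x + 16 * e * S) P≡ ⟨
        16 * P + 16 * e * S                      ∎

  -- Parity of natural numbers

  par : ℕ → Bool
  par zero    = false
  par (suc n) = not (par n)

  par-+ : ∀ m n → par (m + n) ≡ par m xor par n
  par-+ zero    n = refl
  par-+ (suc m) n = trans (cong not (par-+ m n)) (𝔹.not-distribˡ-xor (par m) (par n))

  par-double : ∀ n → par (n + n) ≡ false
  par-double n = trans (par-+ n n) (xor-same (par n))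

  par-* : ∀ m n → par (m * n) ≡ par m ∧ par n
  par-* zero    n = refl
  par-* (suc m) n = begin
    par (n + m * n)             ≡⟨ par-+ n (m * n) ⟩
    par n xor par (m * n)       ≡⟨ cong (par n xor_) (par-* m n) ⟩
    par n xor (par m ∧ par n)   ≡⟨ absorb (par m) (par n) ⟩
    not (par m) ∧ par n         ∎
    where
    open ≡-Reasoning
    absorb : ∀ a b → b xor (a ∧ b) ≡ not a ∧ b
    absorb false b = xor-identityʳ b
    absorb true  b = xor-same b

  par-split : ∀ n → ∃ λ h → n ≡ bit (par n) + 2 * h
  par-split zero    = 0 , refl
  par-split (suc n) with par n | par-split n
  ... | false | h , refl = h , refl
  ... | true  | h , refl = suc h , sym (*-suc 2 h)

  -- Rows of Pascal's triangle modulo 4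

  Row : Set
  Row = ℕ → ℕ

  -- Multiplication of a generating function by t ^ a.
  sh : ℕ → Row → Row
  sh zero    r i       = r i
  sh (suc a) r zero    = 0
  sh (suc a) r (suc i) = sh a r i

  -- Multiplication by (1 + t) ^ n.
  pascal : ℕ → Row → Row
  pascal zero    r = r
  pascal (suc n) r = λ i → pascal n r i + sh 1 (pascal n r) i

  unit : Row
  unit zero    = 1
  unit (suc _) = 0

  binom : ℕ → Row
  binom w = pascal w unit

  sh-cong : ∀ a {r s : Row} → (∀ i → r i ≡ s i) → ∀ i → sh a r i ≡ sh a s i
  sh-cong zero    r≗s i       = r≗s i
  sh-cong (suc a) r≗s zero    = refl
  sh-cong (suc a) r≗s (suc i) = sh-cong a r≗s i

  sh-+ : ∀ a (r s : Row) i → sh a (λ j → r j + s j) i ≡ sh a r i + sh a s i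
  sh-+ zero    r s i       = refl
  sh-+ (suc a) r s zero    = refl
  sh-+ (suc a) r s (suc i) = sh-+ a r s i

  sh-sh : ∀ a b (r : Row) i → sh a (sh b r) i ≡ sh (a + b) r i
  sh-sh zero    b r i       = refl
  sh-sh (suc a) b r zero    = refl
  sh-sh (suc a) b r (suc i) = sh-sh a b r i

  sh-< : ∀ {a i} (r : Row) → i < a → sh a r i ≡ 0
  sh-< {suc a} {zero}  r _         = refl
  sh-< {suc a} {suc i} r (s≤s i<a) = sh-< r i<a

  sh-diag : ∀ a (r : Row) → sh a r a ≡ r 0
  sh-diag zero    r = refl
  sh-diag (suc a) r = sh-diag a r

  pascal-cong : ∀ n {r s : Row} → (∀ i → r i ≡ s i) → ∀ i → pascal n r i ≡ pascal n s i
  pascal-cong zero    r≗s i = r≗s i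
  pascal-cong (suc n) r≗s i = cong₂ _+_ (pascal-cong n r≗s i) (sh-cong 1 (pascal-cong n r≗s) i)

  pascal-+ : ∀ n (r s : Row) i → pascal n (λ j → r j + s j) i ≡ pascal n r i + pascal n s i
  pascal-+ zero    r s i = refl
  pascal-+ (suc n) r s i = trans
    (cong₂ _+_ (pascal-+ n r s i) (trans (sh-cong 1 (pascal-+ n r s) i) (sh-+ 1 (pascal n r) (pascal n s) i)))
    (interchange (pascal n r i) _ _ _)

  pascal-sh : ∀ n a (r : Row) i → pascal n (sh a r) i ≡ sh a (pascal n r) i
  pascal-sh zero    a r i = refl
  pascal-sh (suc n) a r i = begin
    pascal n (sh a r) i + sh 1 (pascal n (sh a r)) i ≡⟨ cong₂ _+_ (pascal-sh n a r i) (sh-cong 1 (pascal-sh n a r) i) ⟩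
    sh a q i + sh 1 (sh a q) i                       ≡⟨ cong (sh a q i +_) (trans (sh-sh 1 a q i) (cong (λ b → sh b q i) (+-comm 1 a))) ⟩
    sh a q i + sh (a + 1) q i                        ≡⟨ cong (sh a q i +_) (sh-sh a 1 q i) ⟨
    sh a q i + sh a (sh 1 q) i                       ≡⟨ sh-+ a q (sh 1 q) i ⟨
    sh a (pascal (suc n) r) i                        ∎
    where
    open ≡-Reasoning
    q = pascal n r

  pascal-pascal : ∀ m n r → pascal (m + n) r ≡ pascal m (pascal n r)
  pascal-pascal zero    n r = refl
  pascal-pascal (suc m) n r = cong (λ q i → q i + sh 1 q i) (pascal-pascal m n r)

  -- (1 + t) ^ d ≡ 1 + t ^ d modulo 2, with the multiple of 2 made explicit.
  Frobenius : ℕ → Set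
  Frobenius d = ∀ r → ∃ λ (X : Row) → ∀ i → pascal d r i ≡ r i + sh d r i + (X i + X i)

  -- Squaring a congruence modulo 2 gives one modulo 4.
  frobenius-square : ∀ d → Frobenius d → ∀ r → ∃ λ (Y : Row) →
    ∀ i → pascal (d + d) r i ≡ r i + (sh d r i + sh d r i) + sh (d + d) r i + (Y i + Y i + (Y i + Y i))
  frobenius-square d frob r = (λ i → X i + sh d X i + Z i) , λ i → begin
    pascal (d + d) r i                   ≡⟨ cong (λ q → q i) (pascal-pascal d d r) ⟩
    pascal d (pascal d r) i              ≡⟨ pascal-cong d X≗ i ⟩
    pascal d (λ j → r j + sh d r j + (X j + X j)) i
      ≡⟨ trans (pascal-+ d _ _ i) (cong₂ _+_ (pascal-+ d r (sh d r) i) (pascal-+ d X X i)) ⟩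
    pascal d r i + pascal d (sh d r) i + (pascal d X i + pascal d X i)
      ≡⟨ cong₂ (λ u v → u + v + (pascal d X i + pascal d X i)) (X≗ i) (shifted i) ⟩
    (r i + sh d r i + (X i + X i)) + (sh d r i + sh (d + d) r i + (sh d X i + sh d X i)) + (pascal d X i + pascal d X i)
      ≡⟨ cong (λ u → (r i + sh d r i + (X i + X i)) + (sh d r i + sh (d + d) r i + (sh d X i + sh d X i)) + (u + u)) (Z≗ i) ⟩
    (r i + sh d r i + (X i + X i)) + (sh d r i + sh (d + d) r i + (sh d X i + sh d X i))
      + ((X i + sh d X i + (Z i + Z i)) + (X i + sh d X i + (Z i + Z i)))
      ≡⟨ collect (r i) (sh d r i) (sh (d + d) r i) (X i) (sh d X i) (Z i) ⟩
    r i + (sh d r i + sh d r i) + sh (d + d) r i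
      + ((X i + sh d X i + Z i) + (X i + sh d X i + Z i) + ((X i + sh d X i + Z i) + (X i + sh d X i + Z i))) ∎
    where
    open ≡-Reasoning
    X = proj₁ (frob r)
    X≗ = proj₂ (frob r)
    Z = proj₁ (frob X)
    Z≗ = proj₂ (frob X)
    shifted : ∀ i → pascal d (sh d r) i ≡ sh d r i + sh (d + d) r i + (sh d X i + sh d X i)
    shifted i = begin
      pascal d (sh d r) i                               ≡⟨ pascal-sh d d r i ⟩
      sh d (pascal d r) i                               ≡⟨ sh-cong d X≗ i ⟩
      sh d (λ j → r j + sh d r j + (X j + X j)) i       ≡⟨ trans (sh-+ d _ _ i) (cong₂ _+_ (sh-+ d r (sh d r) i) (sh-+ d X X i)) ⟩
      sh d r i + sh d (sh d r) i + (sh d X i + sh d X i) ≡⟨ cong (λ u → sh d r i + u + (sh d X i + sh d X i)) (sh-sh d d r i) ⟩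
      sh d r i + sh (d + d) r i + (sh d X i + sh d X i) ∎
    collect : ∀ r s t x y z →
      (r + s + (x + x)) + (s + t + (y + y)) + ((x + y + (z + z)) + (x + y + (z + z)))
      ≡ r + (s + s) + t + ((x + y + z) + (x + y + z) + ((x + y + z) + (x + y + z)))
    collect = solve-∀

  frobenius : ∀ j → Frobenius (2 ^ j)
  frobenius zero    r = (λ _ → 0) , λ i → sym (+-identityʳ _)
  frobenius (suc j) r with frobenius-square (2 ^ j) (frobenius j) r
  -- The cross term 2t^d, which matters modulo 4, joins the even part here.
  ... | Y , Y≗ = (λ i → sh d r i + (Y i + Y i)) , λ i → begin
    pascal (2 ^ suc j) r i ≡⟨ cong (λ e → pascal e r i) d+d ⟩
    pascal (d + d) r i     ≡⟨ Y≗ i ⟩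
    r i + (sh d r i + sh d r i) + sh (d + d) r i + (Y i + Y i + (Y i + Y i))
      ≡⟨ regroup (r i) (sh d r i) (sh (d + d) r i) (Y i) ⟩
    r i + sh (d + d) r i + ((sh d r i + (Y i + Y i)) + (sh d r i + (Y i + Y i)))
      ≡⟨ cong (λ e → r i + sh e r i + ((sh d r i + (Y i + Y i)) + (sh d r i + (Y i + Y i)))) d+d ⟨
    r i + sh (2 ^ suc j) r i + ((sh d r i + (Y i + Y i)) + (sh d r i + (Y i + Y i))) ∎
    where
    open ≡-Reasoning
    d = 2 ^ j
    d+d : 2 ^ suc j ≡ d + d
    d+d = cong (d +_) (+-identityʳ d)
    regroup : ∀ r s t y → r + (s + s) + t + (y + y + (y + y)) ≡ r + t + ((s + (y + y)) + (s + (y + y)))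
    regroup = solve-∀

  binom-0 : ∀ w → binom w 0 ≡ 1
  binom-0 zero    = refl
  binom-0 (suc w) = trans (+-identityʳ _) (binom-0 w)

  binom-< : ∀ {w i} → w < i → binom w i ≡ 0
  binom-< {zero}  {suc i} _         = refl
  binom-< {suc w} {suc i} (s≤s w<i) = cong₂ _+_ (binom-< (m<n⇒m<1+n w<i)) (binom-< w<i)

  binom-shift : ∀ d → Frobenius d → ∀ a w i →
                par (sh a (binom (d + w)) i) ≡ par (sh a (binom w) i) xor par (sh (a + d) (binom w) i)
  binom-shift d frob zero w i = begin
    par (binom (d + w) i)                             ≡⟨ cong (λ q → par (q i)) (pascal-pascal d w unit) ⟩
    par (pascal d (binom w) i)                        ≡⟨ cong par (proj₂ (frob (binom w)) i) ⟩
    par (binom w i + sh d (binom w) i + (X + X))      ≡⟨ par-+ (binom w i + sh d (binom w) i) (X + X) ⟩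
    par (binom w i + sh d (binom w) i) xor par (X + X) ≡⟨ cong₂ _xor_ (par-+ (binom w i) _) (par-double X) ⟩
    (par (binom w i) xor par (sh d (binom w) i)) xor false ≡⟨ xor-identityʳ _ ⟩
    par (binom w i) xor par (sh d (binom w) i)        ∎
    where
    open ≡-Reasoning
    X = proj₁ (frob (binom w)) i
  binom-shift d frob (suc a) w zero    = refl
  binom-shift d frob (suc a) w (suc i) = binom-shift d frob a w i

  binom-flip : ∀ d → Frobenius d → ∀ w → par (binom (d + w) d) ≡ not (par (binom w d))
  binom-flip d frob w = begin
    par (binom (d + w) d)                          ≡⟨ binom-shift d frob 0 w d ⟩
    par (binom w d) xor par (sh d (binom w) d)     ≡⟨ cong (λ u → par (binom w d) xor par u) (trans (sh-diag d (binom w)) (binom-0 w)) ⟩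
    par (binom w d) xor true                       ≡⟨ 𝔹.xor-comm (par (binom w d)) true ⟩
    not (par (binom w d))                          ∎
    where open ≡-Reasoning

  -- Induction in steps of 2d. Modulo 4, (1 + t)^(2d) is 1 + 2t^d + t^(2d), so passing from w to w +
  -- 2d adds 2 to C(w,d) and changes the parity of C(w,2d): both sides of the congruence move by 2.
  binom-mod-4 : ∀ d → Frobenius d → 1 ≤ d → ∀ w → par (binom w d) ≡ false →
                ∃ λ k → binom w d ≡ 2 * bit (par (binom w (d + d))) + k * 4
  binom-mod-4 d frob 1≤d w even = subst P (sym (trans (m≡m%n+[m/n]*n w (d + d)) (+-comm (w % (d + d)) _)))
      (go (w / (d + d)) (w % (d + d)) (m%n<n w (d + d))) even
    where
    open ≡-Reasoning
    instance
      _ : NonZero (d + d)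
      _ = >-nonZero (≤-trans 1≤d (m≤m+n d d))
    P : ℕ → Set
    P w = par (binom w d) ≡ false → ∃ λ k → binom w d ≡ 2 * bit (par (binom w (d + d))) + k * 4

    low : ∀ r → r < d + d → P r
    low r r<2d even with r <? d
    ... | yes r<d = 0 , trans (binom-< r<d) (sym (cong (λ u → 2 * bit (par u) + 0) (binom-< r<2d)))
    -- For d ≤ r < 2d the number C(r,d) is odd, since C(r-d,d) is zero and the parity flips; this
    -- contradicts `even`.
    ... | no  r≮d with trans (sym even) (trans (cong (λ x → par (binom x d)) (sym (m+[n∸m]≡n (≮⇒≥ r≮d))))
                         (trans (binom-flip d frob (r ∸ d)) (cong (λ u → not (par u)) (binom-< r∸d<d))))
      where
      r∸d<d : r ∸ d < d
      r∸d<d = +-cancelˡ-< d _ _ (subst (_< d + d) (sym (m+[n∸m]≡n (≮⇒≥ r≮d))) r<2d)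
    ... | ()

    module _ (w : ℕ) where
      Y = proj₁ (frobenius-square d frob (binom w))

      square : ∀ i → binom (d + d + w) i ≡
               binom w i + (sh d (binom w) i + sh d (binom w) i) + sh (d + d) (binom w) i + (Y i + Y i + (Y i + Y i))
      square i = trans (cong (λ q → q i) (pascal-pascal (d + d) w unit)) (proj₂ (frobenius-square d frob (binom w)) i)

      at-d : binom (d + d + w) d ≡ binom w d + 2 + Y d * 4
      at-d = begin
        binom (d + d + w) d ≡⟨ square d ⟩
        binom w d + (sh d (binom w) d + sh d (binom w) d) + sh (d + d) (binom w) d + (Y d + Y d + (Y d + Y d))
          ≡⟨ cong₂ (λ u v → binom w d + (u + u) + v + (Y d + Y d + (Y d + Y d)))
               (trans (sh-diag d (binom w)) (binom-0 w)) (sh-< (binom w) (m<m+n d 1≤d)) ⟩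
        binom w d + 2 + 0 + (Y d + Y d + (Y d + Y d)) ≡⟨ collect (binom w d) (Y d) ⟩
        binom w d + 2 + Y d * 4 ∎
        where
        collect : ∀ b y → b + 2 + 0 + (y + y + (y + y)) ≡ b + 2 + y * 4
        collect = solve-∀

      at-2d : par (binom (d + d + w) (d + d)) ≡ not (par (binom w (d + d)))
      at-2d = begin
        par (binom (d + d + w) (d + d)) ≡⟨ cong par (square (d + d)) ⟩
        par (b + (s + s) + sh (d + d) (binom w) (d + d) + (y + y + (y + y)))
          ≡⟨ cong (λ u → par (b + (s + s) + u + (y + y + (y + y)))) (trans (sh-diag (d + d) (binom w)) (binom-0 w)) ⟩
        par (b + (s + s) + 1 + (y + y + (y + y))) ≡⟨ cong par (collect b s y) ⟩
        par (suc (b + ((s + y + y) + (s + y + y)))) ≡⟨ cong not (par-+ b _) ⟩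
        not (par b xor par ((s + y + y) + (s + y + y))) ≡⟨ cong (λ u → not (par b xor u)) (par-double (s + y + y)) ⟩
        not (par b xor false) ≡⟨ cong not (xor-identityʳ (par b)) ⟩
        not (par b) ∎
        where
        b = binom w (d + d)
        s = sh d (binom w) (d + d)
        y = Y (d + d)
        collect : ∀ b s y → b + (s + s) + 1 + (y + y + (y + y)) ≡ suc (b + ((s + y + y) + (s + y + y)))
        collect = solve-∀

      even-shift : par (binom (d + d + w) d) ≡ par (binom w d)
      even-shift = begin
        par (binom (d + d + w) d)              ≡⟨ cong par at-d ⟩
        par (binom w d + 2 + Y d * 4)          ≡⟨ par-+ (binom w d + 2) _ ⟩
        par (binom w d + 2) xor par (Y d * 4)  ≡⟨ cong₂ _xor_ (par-+ (binom w d) 2) (trans (par-* (Y d) 4) (𝔹.∧-zeroʳ _)) ⟩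
        (par (binom w d) xor false) xor false  ≡⟨ trans (xor-identityʳ _) (xor-identityʳ _) ⟩
        par (binom w d)                        ∎

      carry : ∀ b k → binom w d ≡ 2 * bit b + k * 4 →
              ∃ λ k′ → binom w d + 2 + Y d * 4 ≡ 2 * bit (not b) + k′ * 4
      carry false k eq = k + Y d , trans (cong (λ u → u + 2 + Y d * 4) eq) (collect k (Y d))
        where
        collect : ∀ k y → k * 4 + 2 + y * 4 ≡ 2 + (k + y) * 4
        collect = solve-∀
      carry true  k eq = 1 + k + Y d , trans (cong (λ u → u + 2 + Y d * 4) eq) (collect k (Y d))
        where
        collect : ∀ k y → 2 + k * 4 + 2 + y * 4 ≡ (1 + k + y) * 4
        collect = solve-∀

      step : P w → P (d + d + w)
      step ih even with ih (trans (sym even-shift) even)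
      ... | k , eq with carry (par (binom w (d + d))) k eq
      ...   | k′ , eq′ = k′ , trans at-d (trans eq′ (cong (λ b → 2 * bit b + k′ * 4) (sym at-2d)))

    go : ∀ q r → r < d + d → P (q * (d + d) + r)
    go zero    r r<2d = low r r<2d
    go (suc q) r r<2d = subst P (sym (+-assoc (d + d) (q * (d + d)) r)) (step (q * (d + d) + r) (go q r r<2d))

  -- Difference operators of step d

  BiFun : Set
  BiFun = ℕ → ℕ → Bool

  _≗₂_ : BiFun → BiFun → Set
  G ≗₂ H = ∀ w v → G w v ≡ H w v

  δx δy : ℕ → BiFun → BiFun
  δx d G w v = G (d + w) v xor G w v
  δy d G w v = G w (d + v) xor G w v

  module _ (d : ℕ) where

    δx-cong : ∀ {G H} → G ≗₂ H → δx d G ≗₂ δx d H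
    δx-cong G≗H w v = cong₂ _xor_ (G≗H (d + w) v) (G≗H w v)

    δy-cong : ∀ {G H} → G ≗₂ H → δy d G ≗₂ δy d H
    δy-cong G≗H w v = cong₂ _xor_ (G≗H w (d + v)) (G≗H w v)

    δ-comm : ∀ G → δy d (δx d G) ≗₂ δx d (δy d G)
    δ-comm G w v = xor-interchange (G (d + w) (d + v)) _ _ _

    -- All that the upper bound remembers of a target. Constant third differences survive shifts of
    -- the weights, which is the effect of fixing variables, and they add when targets are added.
    record Jet (p q r s : Bool) (G : BiFun) : Set where
      field
        xxx : ∀ w v → δx d (δx d (δx d G)) w v ≡ p
        xxy : ∀ w v → δx d (δx d (δy d G)) w v ≡ q
        xyy : ∀ w v → δx d (δy d (δy d G)) w v ≡ r
        yyy : ∀ w v → δy d (δy d (δy d G)) w v ≡ s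

    open Jet

    Jet-shift : ∀ {p q r s G} a b → Jet p q r s G → Jet p q r s (shift a b G)
    Jet-shift {G = G} a b J = record
      { xxx = λ w v → trans (X (δx d (δx d G)) (X (δx d G) (X G (λ _ _ → refl))) w v) (xxx J (a + w) (b + v))
      ; xxy = λ w v → trans (X (δx d (δy d G)) (X (δy d G) (Y G (λ _ _ → refl))) w v) (xxy J (a + w) (b + v))
      ; xyy = λ w v → trans (X (δy d (δy d G)) (Y (δy d G) (Y G (λ _ _ → refl))) w v) (xyy J (a + w) (b + v))
      ; yyy = λ w v → trans (Y (δy d (δy d G)) (Y (δy d G) (Y G (λ _ _ → refl))) w v) (yyy J (a + w) (b + v))
      }
      where
      X : ∀ H {H′} → H′ ≗₂ shift a b H → δx d H′ ≗₂ shift a b (δx d H)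
      X H eq w v = cong₂ _xor_ (trans (eq (d + w) v) (cong (λ u → H u (b + v)) (+-left-comm a d w))) (eq w v)
      Y : ∀ H {H′} → H′ ≗₂ shift a b H → δy d H′ ≗₂ shift a b (δy d H)
      Y H eq w v = cong₂ _xor_ (trans (eq w (d + v)) (cong (H (a + w)) (+-left-comm b d v))) (eq w v)

    Jet-xor : ∀ {p q r s p′ q′ r′ s′ G H} → Jet p q r s G → Jet p′ q′ r′ s′ H →
              Jet (p xor p′) (q xor q′) (r xor r′) (s xor s′) (λ w v → G w v xor H w v)
    Jet-xor {G = G} {H} J K = record
      { xxx = λ w v → trans (X (δx d (δx d G)) (δx d (δx d H)) (X (δx d G) (δx d H) (X G H (λ _ _ → refl))) w v) (cong₂ _xor_ (xxx J w v) (xxx K w v))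
      ; xxy = λ w v → trans (X (δx d (δy d G)) (δx d (δy d H)) (X (δy d G) (δy d H) (Y G H (λ _ _ → refl))) w v) (cong₂ _xor_ (xxy J w v) (xxy K w v))
      ; xyy = λ w v → trans (X (δy d (δy d G)) (δy d (δy d H)) (Y (δy d G) (δy d H) (Y G H (λ _ _ → refl))) w v) (cong₂ _xor_ (xyy J w v) (xyy K w v))
      ; yyy = λ w v → trans (Y (δy d (δy d G)) (δy d (δy d H)) (Y (δy d G) (δy d H) (Y G H (λ _ _ → refl))) w v) (cong₂ _xor_ (yyy J w v) (yyy K w v))
      }
      where
      X : ∀ A B {C} → C ≗₂ (λ w v → A w v xor B w v) → δx d C ≗₂ (λ w v → δx d A w v xor δx d B w v)
      X A B eq w v = trans (cong₂ _xor_ (eq (d + w) v) (eq w v)) (xor-interchange (A (d + w) v) _ _ _)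
      Y : ∀ A B {C} → C ≗₂ (λ w v → A w v xor B w v) → δy d C ≗₂ (λ w v → δy d A w v xor δy d B w v)
      Y A B eq w v = trans (cong₂ _xor_ (eq w (d + v)) (eq w v)) (xor-interchange (A w (d + v)) _ _ _)

    Jet-zero : Jet false false false false (λ _ _ → false)
    Jet-zero = record { xxx = λ _ _ → refl ; xxy = λ _ _ → refl ; xyy = λ _ _ → refl ; yyy = λ _ _ → refl }

  -- Parity of C(w, i) C(v, j), with the columns shifted by a and b.
  prod : ℕ → ℕ → ℕ → ℕ → BiFun
  prod i j a b w v = par (sh a (binom w) i) ∧ par (sh b (binom v) j)

  prod-zeroˡ : ∀ {i a} j b → i < a → ∀ w v → prod i j a b w v ≡ false
  prod-zeroˡ j b i<a w v = cong (λ u → par u ∧ par (sh b (binom v) j)) (sh-< (binom w) i<a)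

  prod-zeroʳ : ∀ {j b} i a → j < b → ∀ w v → prod i j a b w v ≡ false
  prod-zeroʳ i a j<b w v = trans (cong (λ u → par (sh a (binom w) i) ∧ par u) (sh-< (binom v) j<b)) (𝔹.∧-zeroʳ _)

  prod-diag : ∀ i j w v → prod i j i j w v ≡ true
  prod-diag i j w v = cong₂ (λ s t → par s ∧ par t)
    (trans (sh-diag i (binom w)) (binom-0 w)) (trans (sh-diag j (binom v)) (binom-0 v))

  prod-small : ∀ {i j} a b → i + j < a + b → ∀ w v → prod i j a b w v ≡ false
  prod-small {i} {j} a b lt with i <? a
  ... | yes i<a = prod-zeroˡ j b i<a
  ... | no  i≮a = prod-zeroʳ i a (≰⇒> (λ b≤j → <⇒≱ lt (+-mono-≤ (≮⇒≥ i≮a) b≤j)))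

  module _ {d} (frob : Frobenius d) where

    δx-prod : ∀ i j a b → δx d (prod i j a b) ≗₂ prod i j (a + d) b
    δx-prod i j a b w v = trans
      (cong (λ u → (u ∧ par (sh b (binom v) j)) xor prod i j a b w v) (binom-shift d frob a w i))
      (cancel (par (sh a (binom w) i)) _ (par (sh b (binom v) j)))
      where
      cancel : ∀ p q r → ((p xor q) ∧ r) xor (p ∧ r) ≡ q ∧ r
      cancel false q r = xor-identityʳ (q ∧ r)
      cancel true false false = refl
      cancel true false true  = refl
      cancel true true  false = refl
      cancel true true  true  = refl

    δy-prod : ∀ i j a b → δy d (prod i j a b) ≗₂ prod i j a (b + d)
    δy-prod i j a b w v = trans
      (cong (λ u → (par (sh a (binom w) i) ∧ u) xor prod i j a b w v) (binom-shift d frob b v j))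
      (cancel (par (sh a (binom w) i)) (par (sh b (binom v) j)) _)
      where
      cancel : ∀ p q r → (p ∧ (q xor r)) xor (p ∧ q) ≡ p ∧ r
      cancel false q r = refl
      cancel true false r = xor-identityʳ r
      cancel true true false = refl
      cancel true true true = refl

    Jet-prod : ∀ {p q r s} i j →
      (∀ w v → prod i j (d + d + d) 0 w v ≡ p) → (∀ w v → prod i j (d + d) d w v ≡ q) →
      (∀ w v → prod i j d (d + d) w v ≡ r) → (∀ w v → prod i j 0 (d + d + d) w v ≡ s) →
      Jet d p q r s (prod i j 0 0)
    Jet-prod i j p q r s = record
      { xxx = λ w v → trans (X (d + d) 0 (X d 0 (δx-prod i j 0 0)) w v) (p w v)
      ; xxy = λ w v → trans (X d d (X 0 d (δy-prod i j 0 0)) w v) (q w v)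
      ; xyy = λ w v → trans (X 0 (d + d) (Y 0 d (δy-prod i j 0 0)) w v) (r w v)
      ; yyy = λ w v → trans (Y 0 (d + d) (Y 0 d (δy-prod i j 0 0)) w v) (s w v)
      }
      where
      X : ∀ a b {G} → G ≗₂ prod i j a b → δx d G ≗₂ prod i j (a + d) b
      X a b eq w v = trans (δx-cong d eq w v) (δx-prod i j a b w v)
      Y : ∀ a b {G} → G ≗₂ prod i j a b → δy d G ≗₂ prod i j a (b + d)
      Y a b eq w v = trans (δy-cong d eq w v) (δy-prod i j a b w v)

    -- The degree threshold enters here: three differences move the columns by 3d in total, so one
    -- of them passes beyond `i` or `j`.
    Jet-small : ∀ {i j} → i + j < 3 * d → Jet d false false false false (prod i j 0 0)
    Jet-small {i} {j} lt = Jet-prod i j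
      (prod-small (d + d + d) 0 (subst (i + j <_) (e₁ d) lt)) (prod-small (d + d) d (subst (i + j <_) (e₂ d) lt))
      (prod-small d (d + d) (subst (i + j <_) (e₃ d) lt)) (prod-small 0 (d + d + d) (subst (i + j <_) (e₂ d) lt))
      where
      e₁ : ∀ d → 3 * d ≡ d + d + d + 0
      e₁ = solve-∀
      e₂ : ∀ d → 3 * d ≡ d + d + d
      e₂ = solve-∀
      e₃ : ∀ d → 3 * d ≡ d + (d + d)
      e₃ = solve-∀

  -- The witness and its weight on a grid

  Witness : ℕ → BiFun
  Witness d w v = prod (d + d) d 0 0 w v xor prod d (d + d) 0 0 w v

  Balanced : ℕ → BiFun → Set
  Balanced d = Jet d false true true false

  -- The summand C(w,2d) C(v,d) survives only two differences in x and one in y, which lower it to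
  -- C(w,0) C(v,0) = 1; the other summand is its mirror image.
  Witness-balanced : ∀ {d} → Frobenius d → 1 ≤ d → Balanced d (Witness d)
  Witness-balanced {d} frob 1≤d = Jet-xor d
    (Jet-prod frob (d + d) d
      (prod-zeroˡ d 0 (m<m+n (d + d) 1≤d)) (prod-diag (d + d) d)
      (prod-zeroʳ (d + d) d (m<m+n d 1≤d)) (prod-zeroʳ (d + d) 0 (≤-trans (m<m+n d 1≤d) (m≤m+n (d + d) d))))
    (Jet-prod frob d (d + d)
      (prod-zeroˡ (d + d) 0 (≤-trans (m<m+n d 1≤d) (m≤m+n (d + d) d))) (prod-zeroˡ (d + d) d (m<m+n d 1≤d))
      (prod-diag d (d + d)) (prod-zeroʳ d 0 (m<m+n (d + d) 1≤d)))

  -- The differences of order at most two of a balanced function at one point determine it on the d-grid.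
  record State : Set where
    constructor state
    field g gx gy gxx gxy gyy : Bool

  stepx stepy : State → State
  stepx (state g gx gy gxx gxy gyy) = state (gx xor g) (gxx xor gx) (gxy xor gy) gxx (not gxy) (not gyy)
  stepy (state g gx gy gxx gxy gyy) = state (gy xor g) (gxy xor gx) (gyy xor gy) (not gxx) (not gxy) gyy

  stepsx stepsy : ℕ → State → State
  stepsx zero    s = s
  stepsx (suc i) s = stepx (stepsx i s)
  stepsy zero    s = s
  stepsy (suc j) s = stepy (stepsy j s)

  ∀Bool? : ∀ {P : Bool → Set} → (∀ b → Dec (P b)) → Dec (∀ b → P b)
  ∀Bool? P? = map′ (λ { (p , q) → λ { false → p ; true → q } }) (λ p → p false , p true) (P? false ×-dec P? true)

  state-count : State → ℕ
  state-count s = row 0 + (row 1 + (row 2 + row 3))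
    where
    at : ℕ → ℕ → ℕ
    at i j = bit (State.g (stepsx i (stepsy j s)))
    row : ℕ → ℕ
    row i = at i 0 + (at i 1 + (at i 2 + at i 3))

  -- The 64 states are the choices of `gxy`, the coefficient of i₀j₀, and of the five coefficients
  -- of the affine part. Every one gives a bent function of four digits, and 6 is the smaller of the
  -- two possible weights 8 ± 2.
  state-bound : ∀ g gx gy gxx gxy gyy → 6 ≤ state-count (state g gx gy gxx gxy gyy)
  state-bound = from-yes (∀Bool? λ g → ∀Bool? λ gx → ∀Bool? λ gy → ∀Bool? λ gxx → ∀Bool? λ gxy → ∀Bool? λ gyy →
    6 ≤? state-count (state g gx gy gxx gxy gyy))

  Balanced-grid : ∀ {d G} → Balanced d G → GridBound d 6 (λ w v → bit (G w v))
  Balanced-grid {d} {G} J w v = subst (6 ≤_)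
    (cong₂ _+_ (row 0) (cong₂ _+_ (row 1) (cong₂ _+_ (row 2) (row 3))))
    (state-bound (G w v) (δx d G w v) (δy d G w v) (δx d (δx d G) w v) (δx d (δy d G) w v) (δy d (δy d G) w v))
    where
    open Jet
    st : ℕ → ℕ → State
    st w v = state (G w v) (δx d G w v) (δy d G w v) (δx d (δx d G) w v) (δx d (δy d G) w v) (δy d (δy d G) w v)

    undo : ∀ a b → a ≡ (a xor b) xor b
    undo a b = sym (trans (𝔹.xor-assoc a b b) (trans (cong (a xor_) (xor-same b)) (xor-identityʳ a)))

    state-cong : ∀ {a a′ b b′ c c′ e e′ f f′ h h′} → a ≡ a′ → b ≡ b′ → c ≡ c′ → e ≡ e′ → f ≡ f′ → h ≡ h′ →
                 state a b c e f h ≡ state a′ b′ c′ e′ f′ h′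
    state-cong refl refl refl refl refl refl = refl

    st-x : ∀ w v → st (d + w) v ≡ stepx (st w v)
    st-x w v = state-cong (undo _ _) (undo _ _) (undo _ _)
      (trans (undo _ _) (cong (_xor δx d (δx d G) w v) (xxx J w v)))
      (trans (undo _ _) (cong (_xor δx d (δy d G) w v) (xxy J w v)))
      (trans (undo _ _) (cong (_xor δy d (δy d G) w v) (xyy J w v)))

    st-y : ∀ w v → st w (d + v) ≡ stepy (st w v)
    -- States and jets keep the x-differences outermost, so a step in y has to commute the new
    -- difference inwards.
    st-y w v = state-cong (undo _ _)
      (trans (undo _ _) (cong (_xor δx d G w v) (δ-comm d G w v)))
      (undo _ _)
      (trans (undo _ _) (cong (_xor δx d (δx d G) w v)
        (trans (δ-comm d (δx d G) w v) (trans (δx-cong d (δ-comm d G) w v) (xxy J w v)))))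
      (trans (undo _ _) (cong (_xor δx d (δy d G) w v) (trans (δ-comm d (δy d G) w v) (xyy J w v))))
      (trans (undo _ _) (cong (_xor δy d (δy d G) w v) (yyy J w v)))

    sts-y : ∀ j w v → st w (j * d + v) ≡ stepsy j (st w v)
    sts-y zero    w v = refl
    sts-y (suc j) w v = trans (cong (st w) (+-assoc d (j * d) v)) (trans (st-y w (j * d + v)) (cong stepy (sts-y j w v)))

    sts-x : ∀ i w v → st (i * d + w) v ≡ stepsx i (st w v)
    sts-x zero    w v = refl
    sts-x (suc i) w v = trans (cong (λ u → st u v) (+-assoc d (i * d) w)) (trans (st-x (i * d + w) v) (cong stepx (sts-x i w v)))

    at : ∀ i j → bit (State.g (stepsx i (stepsy j (st w v)))) ≡ bit (G (i * d + w) (j * d + v))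
    at i j = cong (bit ∘ State.g) (sym (trans (sts-x i w (j * d + v)) (cong (stepsx i) (sts-y j w v))))

    row : ∀ i → _ ≡ sum₄ d (λ b → bit (G (i * d + w) (b + v)))
    row i = cong₂ _+_ (at i 0) (cong₂ _+_ (at i 1) (cong₂ _+_ (at i 2) (at i 3)))

  -- Elementary symmetric polynomials

  κ : ∀ m {n} → ℕ → ℕ → Vec Bool (m + n) → Bool
  κ m i j S = (wx m S ≡ᵇ i) ∧ (wy m S ≡ᵇ j)

  ∑-elementary : ∀ {n} j (y : Vec Bool n) →
                 ∑ n (λ S → bit (popcount S ≡ᵇ j) * monoVal S y) ≡ binom (popcount y) j
  ∑-elementary zero    []          = refl
  ∑-elementary (suc j) []          = refl
  ∑-elementary {suc n} j (false ∷ y) = trans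
    (∑-cong n (λ S → trans (cong (bit (popcount S ≡ᵇ j) * monoVal S y +_) (*-zeroʳ (bit (suc (popcount S) ≡ᵇ j)))) (+-identityʳ _)))
    (∑-elementary j y)
  ∑-elementary {suc n} j (true ∷ y) = trans (∑-+ n _ _) (cong₂ _+_ (∑-elementary j y) (lower j))
    where
    lower : ∀ j → ∑ n (λ S → bit (suc (popcount S) ≡ᵇ j) * monoVal S y) ≡ sh 1 (binom (popcount y)) j
    lower zero    = ∑-zero n (λ _ → refl)
    lower (suc j) = ∑-elementary j y

  -- `κ m i j` is the coefficient vector of e_i(x) e_j(y), whose value counts the monomials of
  -- bidegree (i,j) inside the support of `z`. The identity is proved over ℕ because it is used both
  -- modulo 2, for absorption, and modulo 4, for the lift.
  ∑-elementary₂ : ∀ m {n} i j (z : Vec Bool (m + n)) →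
                  ∑ (m + n) (λ S → bit (κ m i j S) * monoVal S z) ≡ binom (wx m z) i * binom (wy m z) j
  ∑-elementary₂ zero        zero    j z = trans (∑-elementary j z) (sym (*-identityˡ _))
  ∑-elementary₂ zero {n}    (suc i) j z = ∑-zero n (λ _ → refl)
  ∑-elementary₂ (suc m) {n} i j (false ∷ z) = trans
    (∑-cong (m + n) (λ S → trans (cong (bit (κ m i j S) * monoVal S z +_) (*-zeroʳ (bit (κ (suc m) i j (true ∷ S))))) (+-identityʳ _)))
    (∑-elementary₂ m i j z)
  ∑-elementary₂ (suc m) {n} i j (true ∷ z) = trans (∑-+ (m + n) _ _)
    (trans (cong₂ _+_ (∑-elementary₂ m i j z) (lower i)) (sym (*-distribʳ-+ (binom (wy m z) j) (binom (wx m z) i) _)))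
    where
    lower : ∀ i → ∑ (m + n) (λ S → bit (κ (suc m) i j (true ∷ S)) * monoVal S z)
                ≡ sh 1 (binom (wx m z)) i * binom (wy m z) j
    lower zero    = ∑-zero (m + n) (λ _ → refl)
    lower (suc i) = ∑-elementary₂ m i j z

  ev-∑ : ∀ {n} (c : Vec Bool n → Bool) x → ev c x ≡ par (∑ n (λ S → bit (c S) * monoVal S x))
  ev-∑ c [] with c []
  ... | false = refl
  ... | true  = refl
  ev-∑ {suc n} c (false ∷ x) = trans (ev-∑ (c ∘ (false ∷_)) x) (cong par
    (∑-cong n (λ S → sym (trans (cong (bit (c (false ∷ S)) * monoVal S x +_) (*-zeroʳ (bit (c (true ∷ S))))) (+-identityʳ _)))))
  ev-∑ {suc n} c (true ∷ x) = begin
    ev (c ∘ (false ∷_)) x xor ev (c ∘ (true ∷_)) x ≡⟨ cong₂ _xor_ (ev-∑ (c ∘ (false ∷_)) x) (ev-∑ (c ∘ (true ∷_)) x) ⟩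
    par A xor par B                                ≡⟨ par-+ A B ⟨
    par (A + B)                                    ≡⟨ cong par (∑-+ n _ _) ⟨
    par (∑ (suc n) (λ S → bit (c S) * monoVal S (true ∷ x))) ∎
    where
    open ≡-Reasoning
    A = ∑ n (λ S → bit (c (false ∷ S)) * monoVal S x)
    B = ∑ n (λ S → bit (c (true ∷ S)) * monoVal S x)

  ev-κ : ∀ m {n} i j (z : Vec Bool (m + n)) → ev (κ m i j) z ≡ prod i j 0 0 (wx m z) (wy m z)
  ev-κ m i j z = trans (ev-∑ (κ m i j) z) (trans (cong par (∑-elementary₂ m i j z)) (par-* (binom (wx m z) i) _))

  ≡ᵇ-refl : ∀ n → (n ≡ᵇ n) ≡ true
  ≡ᵇ-refl zero    = refl
  ≡ᵇ-refl (suc n) = ≡ᵇ-refl n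

  ≢⇒≡ᵇ-false : ∀ m n → (m ≡ n → ⊥) → (m ≡ᵇ n) ≡ false
  ≢⇒≡ᵇ-false zero    zero    m≢n = ⊥-elim (m≢n refl)
  ≢⇒≡ᵇ-false zero    (suc n) m≢n = refl
  ≢⇒≡ᵇ-false (suc m) zero    m≢n = refl
  ≢⇒≡ᵇ-false (suc m) (suc n) m≢n = ≢⇒≡ᵇ-false m n (m≢n ∘ cong suc)

  κ-diag : ∀ m {n} i j (S : Vec Bool (m + n)) → wx m S ≡ i → wy m S ≡ j → κ m i j S ≡ true
  κ-diag m i j S refl refl = cong₂ _∧_ (≡ᵇ-refl (wx m S)) (≡ᵇ-refl (wy m S))

  κ-offˣ : ∀ m {n} i j (S : Vec Bool (m + n)) → (wx m S ≡ i → ⊥) → κ m i j S ≡ false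
  κ-offˣ m i j S x≢i = cong (_∧ (wy m S ≡ᵇ j)) (≢⇒≡ᵇ-false (wx m S) i x≢i)

  κ-off : ∀ m {n} i j (S : Vec Bool (m + n)) → (popcount S ≡ i + j → ⊥) → κ m i j S ≡ false
  κ-off m i j S deg with wx m S ≟ i
  ... | no  x≢i = κ-offˣ m i j S x≢i
  ... | yes x≡i = trans (cong ((wx m S ≡ᵇ i) ∧_) (≢⇒≡ᵇ-false (wy m S) j
          (λ y≡j → deg (trans (sym (wx+wy m S)) (cong₂ _+_ x≡i y≡j))))) (𝔹.∧-zeroʳ _)

  -- Disagreement with polynomials of degree less than 3 d

  -- All monomials have total degree at most k, and those of degree exactly k have x-degree less than i.
  Supported : ∀ m {n} → ℕ → ℕ → (Vec Bool (m + n) → Bool) → Set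
  Supported m k i c = (∀ S → k < popcount S → c S ≡ false) × (∀ S → popcount S ≡ k → i ≤ wx m S → c S ≡ false)

  disagreement : ∀ m n → BiFun → (Vec Bool (m + n) → Bool) → ℕ
  disagreement m n G c = ∑ (m + n) (λ z → bit (G (wx m z) (wy m z) xor ev c z))

  module _ (d p q : ℕ) where

    -- A disagreement of density at least p/q for every balanced target: absorption and restriction
    -- lead from the witness to targets that cannot be foreseen.
    Hard : ℕ → ℕ → ℕ → ℕ → Set
    Hard k i m n = ∀ G → Balanced d G → ∀ c → Supported m k i c → p * 2 ^ (m + n) ≤ q * disagreement m n G c

    HardSomewhere : ℕ → ℕ → Set
    HardSomewhere k i = ∃₂ λ m n → Hard k i m n

    -- The (i , j)-part of the polynomial becomes a function of the weights and is absorbed into G.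
    hard-absorb : Frobenius d → ∀ {i j m n M N} → i + j < 3 * d → Hard (i + j) i m n →
      ∀ G → Balanced d G → ∀ c → Supported M (i + j) (suc i) c → (D : Emb m M) (E : Emb n N) (b : Bool) →
      (∀ S → wx m S ≡ i → wy m S ≡ j → c (embed (D ⊕ E) S) ≡ b) →
      p * 2 ^ (M + N) ≤ q * disagreement M N G c
    hard-absorb frob {i} {j} {m} {n} {M} {N} lt hard G bal c (above , top) D E b hom = ∑-restrict (D ⊕ E) p q _ λ ρ →
      let s , t , weights = weights-merge D E ρ
      in subst (λ x → p * 2 ^ (m + n) ≤ q * x) (∑-cong (m + n) (same ρ weights))
           (hard (G′ s t) (Jet-xor d (Jet-shift d s t bal) (jet b)) (c′ ρ) (above′ ρ , top′ ρ))
      where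
      open ≡-Reasoning
      k = i + j

      G′ : ℕ → ℕ → BiFun
      G′ s t w v = shift s t G w v xor (b ∧ prod i j 0 0 w v)

      -- The absorbed term has degree below 3d, so the new target has the third differences of the
      -- old one.
      jet : ∀ b → Jet d false false false false (λ w v → b ∧ prod i j 0 0 w v)
      jet false = Jet-zero d
      jet true  = Jet-small frob lt

      c′ : Vec Bool (M + N) → Vec Bool (m + n) → Bool
      c′ ρ S = res (D ⊕ E) ρ c S xor (b ∧ κ m i j S)

      res-c : ∀ ρ S → k ≤ popcount S → res (D ⊕ E) ρ c S ≡ c (embed (D ⊕ E) S)
      res-c ρ S k≤ = res-top (D ⊕ E) ρ c S (λ S′ lt → above S′ (≤-<-trans k≤ lt))

      above′ : ∀ ρ S → k < popcount S → c′ ρ S ≡ false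
      above′ ρ S k< = cong₂ _xor_
        (trans (res-c ρ S (<⇒≤ k<)) (above _ (subst (k <_) (sym (popcount-embed (D ⊕ E) S)) k<)))
        (trans (cong (b ∧_) (κ-off m i j S (λ eq → <-irrefl (sym eq) k<))) (𝔹.∧-zeroʳ b))

      top′ : ∀ ρ S → popcount S ≡ k → i ≤ wx m S → c′ ρ S ≡ false
      top′ ρ S deg i≤ with wx m S ≟ i
      -- In bidegree (i,j) all coefficients equal `b` on the chosen variables, and `b ∧ κ m i j`
      -- cancels them.
      ... | yes x≡i = trans (cong₂ _xor_
              (trans (res-c ρ S (≤-reflexive (sym deg))) (hom S x≡i y≡j))
              (trans (cong (b ∧_) (κ-diag m i j S x≡i y≡j)) (𝔹.∧-identityʳ b)))
            (xor-same b)
        where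
        y≡j : wy m S ≡ j
        y≡j = +-cancelˡ-≡ i (wy m S) j (trans (cong (_+ wy m S) (sym x≡i)) (trans (wx+wy m S) deg))
      ... | no  x≢i = cong₂ _xor_
              (trans (res-c ρ S (≤-reflexive (sym deg)))
                (top _ (trans (popcount-embed (D ⊕ E) S) deg)
                  (subst (suc i ≤_) (sym (wx-embed D E S)) (≤∧≢⇒< i≤ (x≢i ∘ sym)))))
              (trans (cong (b ∧_) (κ-offˣ m i j S x≢i)) (𝔹.∧-zeroʳ b))

      ev-c′ : ∀ ρ z → ev (c′ ρ) z ≡ ev c (merge (D ⊕ E) ρ z) xor (b ∧ prod i j 0 0 (wx m z) (wy m z))
      ev-c′ ρ z = trans (ev-xor (res (D ⊕ E) ρ c) (λ S → b ∧ κ m i j S) z)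
        (cong₂ _xor_ (ev-res (D ⊕ E) ρ c z) (trans (ev-∧ b (κ m i j) z) (cong (b ∧_) (ev-κ m i j z))))

      same : ∀ ρ {s t} → (∀ z → (wx M (merge (D ⊕ E) ρ z) ≡ s + wx m z) × (wy M (merge (D ⊕ E) ρ z) ≡ t + wy m z)) →
        ∀ z → bit (G′ s t (wx m z) (wy m z) xor ev (c′ ρ) z) ≡
              bit (G (wx M (merge (D ⊕ E) ρ z)) (wy M (merge (D ⊕ E) ρ z)) xor ev c (merge (D ⊕ E) ρ z))
      same ρ {s} {t} weights z = cong bit (begin
        (G (s + wx m z) (t + wy m z) xor r) xor ev (c′ ρ) z ≡⟨ cong₂ (λ g e → (g xor r) xor e)
            (sym (cong₂ G (proj₁ (weights z)) (proj₂ (weights z)))) (ev-c′ ρ z) ⟩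
        (g xor r) xor (ev c (merge (D ⊕ E) ρ z) xor r)      ≡⟨ xor-interchange g r _ r ⟩
        (g xor ev c (merge (D ⊕ E) ρ z)) xor (r xor r)      ≡⟨ cong ((g xor ev c (merge (D ⊕ E) ρ z)) xor_) (xor-same r) ⟩
        (g xor ev c (merge (D ⊕ E) ρ z)) xor false          ≡⟨ xor-identityʳ _ ⟩
        g xor ev c (merge (D ⊕ E) ρ z)                      ∎)
        where
        r = b ∧ prod i j 0 0 (wx m z) (wy m z)
        g = G (wx M (merge (D ⊕ E) ρ z)) (wy M (merge (D ⊕ E) ρ z))

    hard-step : Frobenius d → ∀ i j → i + j < 3 * d → HardSomewhere (i + j) i → HardSomewhere (i + j) (suc i)
    hard-step frob i j lt (m , n , hard) =
      let M , N , ram = ramsey-bipartite i j m n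
      in M , N , λ G bal c supp →
        let D , E , b , hom = ram c in hard-absorb frob lt hard G bal c supp D E b hom

    -- With x-degree bound 0 nothing is left in degree k + 1, and in degree k the bound k + 1 on the
    -- x-degree excludes nothing.
    hard-suc : ∀ {k} → HardSomewhere k (suc k) → HardSomewhere (suc k) 0
    hard-suc (m , n , hard) = m , n , λ G bal c (above , top) → hard G bal c
      ( (λ S k<S → [ above S , (λ eq → top S (sym eq) z≤n) ]′ (m≤n⇒m<n∨m≡n k<S))
      , (λ S deg k<x → ⊥-elim (<⇒≱ k<x (≤-trans (m≤m+n (wx m S) (wy m S)) (≤-reflexive (trans (wx+wy m S) deg))))))

    hard-degree : Frobenius d → ∀ k → k < 3 * d → HardSomewhere k 0 → HardSomewhere (suc k) 0
    hard-degree frob k k< base = hard-suc (climb (suc k) ≤-refl)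
      where
      -- Read from the top down, this strips the bidegrees (k,0), ..., (0,k) from the part of degree
      -- k, one at a time.
      climb : ∀ i → i ≤ suc k → HardSomewhere k i
      climb zero    _         = base
      climb (suc i) (s≤s i≤k) = subst (λ l → HardSomewhere l (suc i)) (m+[n∸m]≡n i≤k)
        (hard-step frob i (k ∸ i) (subst (_< 3 * d) (sym (m+[n∸m]≡n i≤k)) k<)
          (subst (λ l → HardSomewhere l i) (sym (m+[n∸m]≡n i≤k)) (climb i (m≤n⇒m≤1+n i≤k))))

    hard-all : Frobenius d → HardSomewhere 0 0 → ∀ k → k ≤ 3 * d → HardSomewhere k 0
    hard-all frob base zero    _  = base
    hard-all frob base (suc k) k< = hard-degree frob k k< (hard-all frob base k (<⇒≤ k<))

    -- Fixing the surplus variables shifts the target and does not raise the degree of the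
    -- polynomial, so hardness passes to all larger cubes by averaging.
    hard-extend : ∀ {k m n M N} → m ≤ M → n ≤ N → Hard k 0 m n → Hard k 0 M N
    hard-extend {k} {m} {n} {M} {N} m≤M n≤N hard G bal c (above , top) = ∑-restrict E p q _ λ ρ →
        let s , t , weights = weights-merge (Emb-≤ m≤M) (Emb-≤ n≤N) ρ
        in subst (λ x → p * 2 ^ (m + n) ≤ q * x)
             (∑-cong (m + n) (λ z → cong bit (cong₂ _xor_
               (sym (cong₂ G (proj₁ (weights z)) (proj₂ (weights z)))) (ev-res E ρ c z))))
             (hard (shift s t G) (Jet-shift d s t bal) (res E ρ c)
               ( (λ S lt → trans (res-c ρ S (<⇒≤ lt)) (above _ (subst (k <_) (sym (popcount-embed E S)) lt)))
               , (λ S deg _ → trans (res-c ρ S (≤-reflexive (sym deg))) (top _ (trans (popcount-embed E S) deg) z≤n))))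
      where
      E = Emb-≤ m≤M ⊕ Emb-≤ n≤N
      res-c : ∀ ρ S → k ≤ popcount S → res E ρ c S ≡ c (embed E S)
      res-c ρ S k≤ = res-top E ρ c S (λ S′ lt → above S′ (≤-<-trans k≤ lt))

  -- Only the zero polynomial is left, and the disagreement is the number of points where the target
  -- is 1. The density p/q is 6/16 - 1/e when `6 * e` is at least 16.
  hard-zero : ∀ d e → 1 ≤ d → HardSomewhere d (6 * e ∸ 16) (16 * e) 0 0
  hard-zero d e 1≤d =
    let m , bound = equidistribution d 6 e 1≤d (m≤m+n 6 10) in m , m , unrestricted m bound
    where
    p = 6 * e ∸ 16
    q = 16 * e
    unrestricted : ∀ m → (∀ f → GridBound d 6 f → p * 2 ^ (m + m) ≤ q * ∑ (m + m) (λ z → f (wx m z) (wy m z))) →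
                   Hard d p q 0 0 m m
    unrestricted m bound G bal c (above , top) = subst (λ x → p * 2 ^ (m + m) ≤ q * x)
      (∑-cong (m + m) (λ z → cong bit (sym (trans (cong (G (wx m z) (wy m z) xor_) (vanish z)) (xor-identityʳ _)))))
      (bound (λ w v → bit (G w v)) (Balanced-grid bal))
      where
      vanish : ∀ z → ev c z ≡ false
      vanish z = trans
        (ev-cong (λ S → [ above S , (λ eq → top S (sym eq) z≤n) ]′ (m≤n⇒m<n∨m≡n z≤n)) z)
        (ev-zero z)

  -- Counting over the enumerated cube

  sum-cube : ∀ n (f : Vec Bool n → ℕ) → sum (map f (cube n)) ≡ ∑ n f
  sum-cube zero    f = +-identityʳ (f [])
  sum-cube (suc n) f = trans (pairs (cube n)) (sum-cube n _)
    where
    pairs : ∀ L → sum (map f (List.concatMap (λ v → (false ∷ v) ∷ (true ∷ v) ∷ []) L))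
                ≡ sum (map (λ v → f (false ∷ v) + f (true ∷ v)) L)
    pairs []      = refl
    pairs (v ∷ L) = trans (cong (λ s → f (false ∷ v) + (f (true ∷ v) + s)) (pairs L)) (sym (+-assoc (f (false ∷ v)) _ _))

  length-filterᵇ : ∀ {A : Set} (p : A → Bool) L → length (filterᵇ p L) ≡ sum (map (bit ∘ p) L)
  length-filterᵇ p []      = refl
  length-filterᵇ p (x ∷ L) with p x
  ... | true  = cong suc (length-filterᵇ p L)
  ... | false = length-filterᵇ p L

  sum-filterᵇ : ∀ {A : Set} (p : A → Bool) (f : A → ℕ) → (∀ x → p x ≡ false → f x ≡ 0) →
                ∀ L → sum (map f (filterᵇ p L)) ≡ sum (map f L)
  sum-filterᵇ p f off []      = refl
  sum-filterᵇ p f off (x ∷ L) with p x in eq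
  ... | true  = cong (f x +_) (sum-filterᵇ p f off L)
  ... | false = trans (sum-filterᵇ p f off L) (cong (_+ sum (map f L)) (sym (off x eq)))

  count : ∀ {n} → (Vec Bool n → Bool) → ℕ
  count {n} p = length (filterᵇ p (cube n))

  count-∑ : ∀ {n} (p : Vec Bool n → Bool) → count p ≡ ∑ n (bit ∘ p)
  count-∑ {n} p = trans (length-filterᵇ p (cube n)) (sum-cube n (bit ∘ p))

  agreement : ∀ {n} k → (Vec Bool n → Bool) → Poly n k → ℕ
  agreement k F Q = count (λ x → does (lift k F x ≟ eval Q x))

  -- Polynomials modulo 2

  mod-2 : ∀ n → n % 2 ≡ bit (par n)
  mod-2 n with par n | par-split n
  ... | b | h , refl = trans (cong (λ x → (bit b + x) % 2) (*-comm 2 h)) (trans ([m+kn]%n≡m%n (bit b) h 2) (small b))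
    where
    small : ∀ b → bit b % 2 ≡ bit b
    small false = refl
    small true  = refl

  eqᵇ : ∀ {n} → Vec Bool n → Vec Bool n → Bool
  eqᵇ []          []          = true
  eqᵇ (false ∷ M) (false ∷ S) = eqᵇ M S
  eqᵇ (false ∷ M) (true ∷ S)  = false
  eqᵇ (true ∷ M)  (false ∷ S) = false
  eqᵇ (true ∷ M)  (true ∷ S)  = eqᵇ M S

  eqᵇ-off : ∀ {n} (M S : Vec Bool n) → popcount M < popcount S → eqᵇ M S ≡ false
  eqᵇ-off (false ∷ M) (false ∷ S) lt       = eqᵇ-off M S lt
  eqᵇ-off (false ∷ M) (true ∷ S)  lt       = refl
  eqᵇ-off (true ∷ M)  (false ∷ S) lt       = refl
  eqᵇ-off (true ∷ M)  (true ∷ S)  (s≤s lt) = eqᵇ-off M S lt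

  ev-eqᵇ : ∀ {n} (M x : Vec Bool n) → ev (eqᵇ M) x ≡ par (monoVal M x)
  ev-eqᵇ []          []          = refl
  ev-eqᵇ (false ∷ M) (false ∷ x) = ev-eqᵇ M x
  ev-eqᵇ (false ∷ M) (true ∷ x)  = trans (cong₂ _xor_ (ev-eqᵇ M x) (ev-zero x)) (xor-identityʳ _)
  ev-eqᵇ (true ∷ M)  (false ∷ x) = ev-zero x
  ev-eqᵇ (true ∷ M)  (true ∷ x)  = cong₂ _xor_ (ev-zero x) (ev-eqᵇ M x)

  coefficients : ∀ {n k} → Poly n k → Vec Bool n → Bool
  coefficients []             S = false
  coefficients (term M a ∷ Q) S = (par (toℕ a) ∧ eqᵇ M S) xor coefficients Q S

  ev-coefficients : ∀ {n} (Q : Poly n 1) x → eval Q x ≡ bit (ev (coefficients Q) x)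
  ev-coefficients Q x = trans (mod-2 (total Q)) (cong bit (parity Q))
    where
    total : Poly _ 1 → ℕ
    total Q = sum (map (λ t → toℕ (Term.coeff t) * monoVal (Term.mono t) x) Q)
    parity : ∀ Q → par (total Q) ≡ ev (coefficients Q) x
    parity []             = sym (ev-zero x)
    parity (term M a ∷ Q) = trans (par-+ (toℕ a * monoVal M x) _) (trans
      (cong₂ _xor_ (trans (par-* (toℕ a) (monoVal M x))
        (sym (trans (ev-∧ (par (toℕ a)) (eqᵇ M) x) (cong (par (toℕ a) ∧_) (ev-eqᵇ M x))))) (parity Q))
      (sym (ev-xor (λ S → par (toℕ a) ∧ eqᵇ M S) (coefficients Q) x)))

  DegreeBelow : ∀ {n k} → ℕ → Poly n k → Set
  DegreeBelow D = All (λ t → popcount (Term.mono t) < D)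

  coefficients-vanish : ∀ {n k D} {Q : Poly n k} → DegreeBelow D Q → ∀ S → D ≤ popcount S → coefficients Q S ≡ false
  coefficients-vanish []                             S D≤ = refl
  coefficients-vanish {Q = term M a ∷ Q} (deg ∷ degs) S D≤ = cong₂ _xor_
    (trans (cong (par (toℕ a) ∧_) (eqᵇ-off M S (<-≤-trans deg D≤))) (𝔹.∧-zeroʳ _))
    (coefficients-vanish degs S D≤)

  assignments-degree : ∀ {n} k D (Ss : List (Vec Bool n)) → All (λ S → popcount S < D) Ss →
                       All (DegreeBelow D) (assignments k Ss)
  assignments-degree k D []       []           = [] ∷ []
  assignments-degree k D (S ∷ Ss) (deg ∷ degs) = Allₚ.concat⁺ (Allₚ.map⁺ (All.map
    (λ {Q} Q-deg → Allₚ.map⁺ (All.universal (λ c → deg ∷ Q-deg) (List.allFin (2 ^ k)))) (assignments-degree k D Ss degs)))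

  polys-degree : ∀ n D k → All (DegreeBelow (suc D)) (polys n D k)
  polys-degree n D k = assignments-degree k (suc D) (monomials n D) (All.map (λ {S} le → s≤s (≤ᵇ⇒≤ (popcount S) D le))
    (Allₚ.all-filter (λ S → T? (popcount S ≤ᵇ D)) (cube n)))

  agree+disagree : ∀ n N G (Q : Poly (n + N) 1) →
    agreement 1 (λ z → G (wx n z) (wy n z)) Q + disagreement n N G (coefficients Q) ≡ 2 ^ (n + N)
  agree+disagree n N G Q = begin
    agreement 1 F Q + disagreement n N G (coefficients Q) ≡⟨ cong (_+ disagreement n N G (coefficients Q)) (count-∑ {n + N} _) ⟩
    ∑ (n + N) _ + ∑ (n + N) _                              ≡⟨ ∑-+ (n + N) _ _ ⟨
    ∑ (n + N) _                                            ≡⟨ ∑-cong (n + N) one ⟩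
    ∑ (n + N) (λ _ → 1)                                    ≡⟨ ∑-const (n + N) 1 ⟩
    1 * 2 ^ (n + N)                                        ≡⟨ *-identityˡ _ ⟩
    2 ^ (n + N)                                            ∎
    where
    open ≡-Reasoning
    F : Vec Bool (n + N) → Bool
    F z = G (wx n z) (wy n z)
    complement : ∀ a b → bit (does (bit a ≟ bit b)) + bit (a xor b) ≡ 1
    complement false false = refl
    complement false true  = refl
    complement true  false = refl
    complement true  true  = refl
    one : ∀ z → bit (does (lift 1 F z ≟ eval Q z)) + bit (F z xor ev (coefficients Q) z) ≡ 1
    one z = trans (cong (λ e → bit (does (bit (F z) ≟ e)) + bit (F z xor ev (coefficients Q) z)) (ev-coefficients Q z))
                  (complement (F z) (ev (coefficients Q) z))

  -- Disagreement at least 6/16 - 1/e means agreement at most 10/16 + 1/e. Adding 16 back to the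
  -- truncated difference gives at least `6 * e`, which also covers small `e`.
  complement-bound : ∀ e A D P → A + D ≡ P → (6 * e ∸ 16) * P ≤ 16 * e * D → 16 * e * A ≤ (10 * e + 16) * P
  complement-bound e A D P A+D≡P bound = +-cancelʳ-≤ (6 * e * P) _ _ (begin
    16 * e * A + 6 * e * P                        ≤⟨ +-monoʳ-≤ (16 * e * A) (*-monoˡ-≤ P (m≤n+m∸n (6 * e) 16)) ⟩
    16 * e * A + (16 + (6 * e ∸ 16)) * P          ≡⟨ cong (16 * e * A +_) (*-distribʳ-+ P 16 (6 * e ∸ 16)) ⟩
    16 * e * A + (16 * P + (6 * e ∸ 16) * P)      ≤⟨ +-monoʳ-≤ (16 * e * A) (+-monoʳ-≤ (16 * P) bound) ⟩
    16 * e * A + (16 * P + 16 * e * D)            ≡⟨ regroup e A D P ⟩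
    16 * e * (A + D) + 16 * P                     ≡⟨ cong (λ x → 16 * e * x + 16 * P) A+D≡P ⟩
    16 * e * P + 16 * P                           ≡⟨ split e P ⟩
    (10 * e + 16) * P + 6 * e * P                 ∎)
    where
    open ≤-Reasoning
    regroup : ∀ e A D P → 16 * e * A + (16 * P + 16 * e * D) ≡ 16 * e * (A + D) + 16 * P
    regroup = solve-∀
    split : ∀ e P → 16 * e * P + 16 * P ≡ (10 * e + 16) * P + 6 * e * P
    split = solve-∀

  -- Agreement with polynomials of degree below 3d

  WitnessFunction : ∀ d n → Vec Bool (2 * n) → Bool
  WitnessFunction d n z = Witness d (wx n z) (wy n z)

  agreement-upper : ∀ {d} → Frobenius d → 1 ≤ d → ∀ e → ∃ λ N₀ → ∀ n → N₀ ≤ n →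
    All (λ Q → 16 * e * agreement 1 (WitnessFunction d n) Q ≤ (10 * e + 16) * 2 ^ (2 * n)) (polys (2 * n) (3 * d ∸ 1) 1)
  agreement-upper {d} frob 1≤d e = extend (hard-all d (6 * e ∸ 16) (16 * e) frob (hard-zero d e 1≤d) (3 * d) ≤-refl)
    where
    extend : HardSomewhere d (6 * e ∸ 16) (16 * e) (3 * d) 0 → ∃ λ N₀ → ∀ n → N₀ ≤ n →
      All (λ Q → 16 * e * agreement 1 (WitnessFunction d n) Q ≤ (10 * e + 16) * 2 ^ (2 * n)) (polys (2 * n) (3 * d ∸ 1) 1)
    extend (M , N , hard) = M ⊔ N , λ n N₀≤n →
      -- Degree at most `3 * d ∸ 1` becomes degree below `3 * d`, as `d` is positive.
      All.map (λ {Q} deg → bound n N₀≤n Q (subst (λ D → DegreeBelow D Q) (m+[n∸m]≡n 1≤3d) deg)) (polys-degree (2 * n) (3 * d ∸ 1) 1)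
      where
      1≤3d : 1 ≤ 3 * d
      1≤3d = ≤-trans 1≤d (m≤m+n d _)
      bound : ∀ n → M ⊔ N ≤ n → (Q : Poly (2 * n) 1) → DegreeBelow (3 * d) Q →
        16 * e * agreement 1 (WitnessFunction d n) Q ≤ (10 * e + 16) * 2 ^ (2 * n)
      bound n N₀≤n Q deg = complement-bound e _ _ (2 ^ (2 * n)) (agree+disagree n (n + 0) (Witness d) Q)
        (hard-extend d (6 * e ∸ 16) (16 * e) (m⊔n≤o⇒m≤o M N N₀≤n)
          (≤-trans (m⊔n≤o⇒n≤o M N N₀≤n) (m≤m+n n 0)) hard
          (Witness d) (Witness-balanced frob 1≤d) (coefficients Q)
          ((λ S lt → coefficients-vanish deg S (<⇒≤ lt)) , (λ S eq _ → coefficients-vanish deg S (≤-reflexive (sym eq)))))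

  -- Agreement modulo 4

  coefficient₄ : Bool → Fin 4
  coefficient₄ b = if b then sucF 0F else 0F

  -- This is e_d(x) e_d(y). Zero coefficients are listed too, because the members of `polys` assign
  -- a coefficient to every monomial of the allowed degree.
  ElementaryPoly : ∀ d n → Poly (2 * n) 2
  ElementaryPoly d n = map (λ S → term S (coefficient₄ (κ n d d S))) (monomials (2 * n) (2 * d))

  assignments-∈ : ∀ {n} k (c : Vec Bool n → Fin (2 ^ k)) Ss → map (λ S → term S (c S)) Ss ∈ assignments k Ss
  assignments-∈ k c []       = here refl
  assignments-∈ k c (S ∷ Ss) = ∈-concatMap⁺ (λ p → map (λ a → term S a ∷ p) (List.allFin (2 ^ k))) (Any.map
    (λ { refl → ∈-map⁺ (λ a → term S a ∷ map (λ S → term S (c S)) Ss) (∈-allFin (c S)) }) (assignments-∈ k c Ss))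

  ElementaryPoly-∈ : ∀ d n → ElementaryPoly d n ∈ polys (2 * n) (2 * d) 2
  ElementaryPoly-∈ d n = assignments-∈ 2 (λ S → coefficient₄ (κ n d d S)) (monomials (2 * n) (2 * d))

  eval-elementary : ∀ d n z → eval (ElementaryPoly d n) z ≡ (binom (wx n z) d * binom (wy n z) d) % 4
  eval-elementary d n z = cong (_% 4) (begin
    sum (map value (map (λ S → term S (coefficient₄ (κ n d d S))) (monomials (2 * n) (2 * d)))) ≡⟨ cong sum (map-∘ (monomials (2 * n) (2 * d))) ⟨
    sum (map weight (monomials (2 * n) (2 * d)))           ≡⟨ sum-filterᵇ (λ S → popcount S ≤ᵇ 2 * d) weight off (cube (2 * n)) ⟩
    sum (map weight (cube (2 * n)))                        ≡⟨ sum-cube (2 * n) weight ⟩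
    ∑ (2 * n) weight                                       ≡⟨ ∑-cong (2 * n) (λ S → cong (_* monoVal S z) (toℕ-coefficient (κ n d d S))) ⟩
    ∑ (n + (n + 0)) (λ S → bit (κ n d d S) * monoVal S z)  ≡⟨ ∑-elementary₂ n d d z ⟩
    binom (wx n z) d * binom (wy n z) d                    ∎)
    where
    open ≡-Reasoning
    value : Term (2 * n) 2 → ℕ
    value t = toℕ (Term.coeff t) * monoVal (Term.mono t) z
    weight : Vec Bool (2 * n) → ℕ
    weight S = toℕ (coefficient₄ (κ n d d S)) * monoVal S z
    toℕ-coefficient : ∀ b → toℕ (coefficient₄ b) ≡ bit b
    toℕ-coefficient false = refl
    toℕ-coefficient true  = refl
    off : ∀ S → (popcount S ≤ᵇ 2 * d) ≡ false → weight S ≡ 0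
    off S high = cong (λ b → toℕ (coefficient₄ b) * monoVal S z) (κ-off n d d S (λ eq →
      subst T high (≤⇒≤ᵇ (≤-reflexive (trans eq (cong (d +_) (sym (+-identityʳ d))))))))

  -- When one factor is even, only the parity of the other matters modulo 4.
  product-mod-4 : ∀ {u a} v → (∃ λ k → u ≡ 2 * bit a + k * 4) → (u * v) % 4 ≡ (if a ∧ par v then 2 else 0)
  product-mod-4 {a = a} v (k , refl) with par v | par-split v
  ... | b | h , refl = begin
    ((2 * bit a + k * 4) * (bit b + 2 * h)) % 4                              ≡⟨ cong (_% 4) (expand (bit a) k (bit b) h) ⟩
    (2 * (bit a * bit b) + (bit a * h + k * (bit b + 2 * h)) * 4) % 4       ≡⟨ [m+kn]%n≡m%n (2 * (bit a * bit b)) (bit a * h + k * (bit b + 2 * h)) 4 ⟩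
    (2 * (bit a * bit b)) % 4                                               ≡⟨ small a b ⟩
    (if a ∧ b then 2 else 0)                                                ∎
    where
    open ≡-Reasoning
    expand : ∀ a k b h → (2 * a + k * 4) * (b + 2 * h) ≡ 2 * (a * b) + (a * h + k * (b + 2 * h)) * 4
    expand = solve-∀
    small : ∀ a b → (2 * (bit a * bit b)) % 4 ≡ (if a ∧ b then 2 else 0)
    small false b     = refl
    small true  false = refl
    small true  true  = refl

  oddPair : ℕ → BiFun
  oddPair d w v = par (binom w d) ∧ par (binom v d)

  witness-mod-4 : ∀ {d} → Frobenius d → 1 ≤ d → ∀ w v → oddPair d w v ≡ false →
                  (if Witness d w v then 2 else 0) ≡ (binom w d * binom v d) % 4
  witness-mod-4 {d} frob 1≤d w v even with par (binom w d) in a₀ | par (binom v d) in b₀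
  ... | false | _ = sym (trans (product-mod-4 (binom v d) (binom-mod-4 d frob 1≤d w a₀))
    (cong (if_then 2 else 0) (trans (cong (par (binom w (d + d)) ∧_) b₀) (sym (xor-identityʳ _)))))
  ... | true | false = sym (trans (cong (_% 4) (*-comm (binom w d) (binom v d)))
    (trans (product-mod-4 (binom w d) (binom-mod-4 d frob 1≤d v b₀))
      (cong (if_then 2 else 0) (trans (cong (par (binom v (d + d)) ∧_) a₀) (trans (𝔹.∧-identityʳ _)
        (cong (_xor par (binom v (d + d))) (sym (𝔹.∧-zeroʳ (par (binom w (d + d)))))))))))

  -- The parity of C(w,d) alternates along a line of step d, so both parities are odd at exactly 4
  -- of the 16 points.
  even-grid : ∀ {d} → Frobenius d → GridBound d 12 (λ w v → bit (not (oddPair d w v)))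
  even-grid {d} frob w v = ≤-reflexive (trans (twelve (par (binom w d)) (par (binom v d)))
      (cong₂ _+_ (row 0) (cong₂ _+_ (row 1) (cong₂ _+_ (row 2) (row 3)))))
    where
    flip : ℕ → Bool → Bool
    flip zero    b = b
    flip (suc i) b = not (flip i b)

    flips : ∀ i w → flip i (par (binom w d)) ≡ par (binom (i * d + w) d)
    flips zero    w = refl
    flips (suc i) w = trans (cong not (flips i w)) (trans (sym (binom-flip d frob (i * d + w)))
      (cong (λ x → par (binom x d)) (sym (+-assoc d (i * d) w))))

    rowSum : ℕ → Bool → Bool → ℕ
    rowSum i a b = at 0 + (at 1 + (at 2 + at 3))
      where
      at : ℕ → ℕ
      at j = bit (not (flip i a ∧ flip j b))

    twelve : ∀ a b → 12 ≡ rowSum 0 a b + (rowSum 1 a b + (rowSum 2 a b + rowSum 3 a b))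
    twelve false false = refl
    twelve false true  = refl
    twelve true  false = refl
    twelve true  true  = refl

    row : ∀ i → rowSum i (par (binom w d)) (par (binom v d)) ≡
                sum₄ d (λ b → bit (not (oddPair d (i * d + w) (b + v))))
    row i = cong₂ _+_ (at 0) (cong₂ _+_ (at 1) (cong₂ _+_ (at 2) (at 3)))
      where
      at : ∀ j → bit (not (flip i (par (binom w d)) ∧ flip j (par (binom v d)))) ≡
                 bit (not (oddPair d (i * d + w) (j * d + v)))
      at j = cong₂ (λ a b → bit (not (a ∧ b))) (flips i w) (flips j v)

  agreement-lower : ∀ {d} → Frobenius d → 1 ≤ d → ∀ e → ∃ λ N₀ → ∀ n → N₀ ≤ n →
    12 * e * 2 ^ (2 * n) ≤ 16 * e * agreement 2 (WitnessFunction d n) (ElementaryPoly d n) + 16 * 2 ^ (2 * n)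
  agreement-lower {d} frob 1≤d e = extend (equidistribution d 12 e 1≤d (m≤m+n 12 4))
    where
    f : ℕ → ℕ → ℕ
    f w v = bit (not (oddPair d w v))

    extend : (∃ λ m → ∀ f → GridBound d 12 f →
        (12 * e ∸ 16) * 2 ^ (m + m) ≤ 16 * e * ∑ (m + m) (λ z → f (wx m z) (wy m z))) →
      ∃ λ N₀ → ∀ n → N₀ ≤ n →
        12 * e * 2 ^ (2 * n) ≤ 16 * e * agreement 2 (WitnessFunction d n) (ElementaryPoly d n) + 16 * 2 ^ (2 * n)
    extend (m , bound) = m , λ n m≤n → estimate n (Emb-≤ m≤n) (Emb-≤ (≤-trans m≤n (m≤m+n n 0)))
      where
      open ≤-Reasoning
      agree : ∀ n z → f (wx n z) (wy n z) ≤ bit (does (lift 2 (WitnessFunction d n) z ≟ eval (ElementaryPoly d n) z))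
      agree n z with oddPair d (wx n z) (wy n z) in even
      ... | true  = z≤n
      ... | false = ≤-reflexive (cong bit (sym (dec-true (lift 2 (WitnessFunction d n) z ≟ eval (ElementaryPoly d n) z)
        (trans (witness-mod-4 frob 1≤d (wx n z) (wy n z) even) (sym (eval-elementary d n z))))))

      estimate : ∀ n → Emb m n → Emb m (n + 0) →
        12 * e * 2 ^ (2 * n) ≤ 16 * e * agreement 2 (WitnessFunction d n) (ElementaryPoly d n) + 16 * 2 ^ (2 * n)
      estimate n D E = begin
        12 * e * P                           ≤⟨ *-monoˡ-≤ P (m≤n+m∸n (12 * e) 16) ⟩
        (16 + (12 * e ∸ 16)) * P             ≡⟨ *-distribʳ-+ P 16 (12 * e ∸ 16) ⟩
        16 * P + (12 * e ∸ 16) * P           ≤⟨ +-monoʳ-≤ (16 * P) restricted ⟩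
        16 * P + 16 * e * S                  ≤⟨ +-monoʳ-≤ (16 * P) (*-monoʳ-≤ (16 * e) (∑-mono (2 * n) (agree n))) ⟩
        16 * P + 16 * e * ∑ (2 * n) _        ≡⟨ cong (λ x → 16 * P + 16 * e * x) (count-∑ {2 * n} _) ⟨
        16 * P + 16 * e * A                  ≡⟨ +-comm (16 * P) (16 * e * A) ⟩
        16 * e * A + 16 * P                  ∎
        where
        P = 2 ^ (2 * n)
        A = agreement 2 (WitnessFunction d n) (ElementaryPoly d n)
        S = ∑ (n + (n + 0)) (λ z → f (wx n z) (wy n z))
        restricted : (12 * e ∸ 16) * P ≤ 16 * e * S
        -- Equidistribution is known for `m` variables in each half. On every subcube of that size
        -- the fixed variables only shift the weights, and the grid bound is invariant under shifts.
        restricted = ∑-restrict (D ⊕ E) (12 * e ∸ 16) (16 * e) _ λ ρ →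
          let s , t , weights = weights-merge D E ρ
          in subst (λ x → (12 * e ∸ 16) * 2 ^ (m + m) ≤ 16 * e * x)
               (∑-cong (m + m) (λ z → sym (cong₂ f (proj₁ (weights z)) (proj₂ (weights z)))))
               (bound (shift s t f) (GridBound-shift {d} s t {f} (even-grid frob)))

open import Data.Bool using (Bool)
open import Data.Integer using (+_)
import Data.Integer as ℤ
import Data.Integer.Properties as ℤₚ
open import Data.List using ([]; _∷_; foldr)
open import Data.List.Membership.Propositional using (_∈_)
open import Data.List.Relation.Unary.All as All using (All; []; _∷_)
open import Data.List.Relation.Unary.Any using (here; there)
open import Data.Nat using (ℕ; suc; _*_; _^_; _∸_; _≤_; NonZero)
import Data.Nat as ℕ
import Data.Nat.Properties as ℕₚ
open import Data.Nat.Tactic.RingSolver using (solve-∀)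
open import Data.Product using (Σ; ∃; _×_; _,_)
open import Data.Rational using (ℚ; _/_; _+_; _-_; 0ℚ) renaming (_≤_ to _≤ℚ_; _<_ to _<ℚ_)
import Data.Rational as ℚ
import Data.Rational.Properties as ℚₚ
import Data.Rational.Unnormalised as ℚᵘ
import Data.Rational.Unnormalised.Properties as ℚᵘₚ
open import Data.Vec using (Vec)
open import Relation.Binary.PropositionalEquality using (_≡_; refl; sym; trans; cong; cong₂; subst; subst₂)
open Agreement using (frobenius; agreement; WitnessFunction; ElementaryPoly; ElementaryPoly-∈; agreement-lower; agreement-upper)

-- From counts to rational bounds on γ

fraction-≤ : ∀ a b c d x y .{{_ : NonZero b}} .{{_ : NonZero d}} .{{_ : NonZero y}} →
             a * (d * y) ≤ (c * y ℕ.+ x * d) * b → (+ a / b) ≤ℚ (+ c / d) + (+ x / y)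
fraction-≤ a b@(suc b-1) c d@(suc d-1) x y@(suc y-1) le = ℚₚ.toℚᵘ-cancel-≤ (begin
  ℚ.toℚᵘ (+ a / b)                      ≃⟨ ℚₚ.toℚᵘ-fromℚᵘ (ℚᵘ.mkℚᵘ (+ a) b-1) ⟩
  ℚᵘ.mkℚᵘ (+ a) b-1                     ≤⟨ ℚᵘ.*≤* (subst₂ ℤ._≤_ (ℤₚ.pos-* a (d * y)) numerator (ℤ.+≤+ le)) ⟩
  ℚᵘ.mkℚᵘ (+ c) d-1 ℚᵘ.+ ℚᵘ.mkℚᵘ (+ x) y-1
    ≃⟨ ℚᵘₚ.+-cong (ℚₚ.toℚᵘ-fromℚᵘ (ℚᵘ.mkℚᵘ (+ c) d-1)) (ℚₚ.toℚᵘ-fromℚᵘ (ℚᵘ.mkℚᵘ (+ x) y-1)) ⟨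
  ℚ.toℚᵘ (+ c / d) ℚᵘ.+ ℚ.toℚᵘ (+ x / y) ≃⟨ ℚₚ.toℚᵘ-homo-+ (+ c / d) (+ x / y) ⟨
  ℚ.toℚᵘ ((+ c / d) + (+ x / y))        ∎)
  where
  open ℚᵘₚ.≤-Reasoning
  numerator : + ((c * y ℕ.+ x * d) * b) ≡ (+ c ℤ.* + y ℤ.+ + x ℤ.* + d) ℤ.* + b
  numerator = trans (ℤₚ.pos-* (c * y ℕ.+ x * d) b) (cong (ℤ._* + b)
    (trans (ℤₚ.pos-+ (c * y) (x * d)) (cong₂ ℤ._+_ (ℤₚ.pos-* c y) (ℤₚ.pos-* x d))))

-- A positive rational has numerator at least 1. Hence the denominator of ε can serve as the
-- parameter `e` of the counting bounds, whose error is 1/e.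
1/denominator≤ : ∀ ε → 0ℚ <ℚ ε → (+ 1 / ℚ.↧ₙ ε) ≤ℚ ε
1/denominator≤ ε@(ℚ.mkℚ (+ suc p) q-1 _) _ = ℚₚ.toℚᵘ-cancel-≤ (begin
  ℚ.toℚᵘ (+ 1 / suc q-1)   ≃⟨ ℚₚ.toℚᵘ-fromℚᵘ (ℚᵘ.mkℚᵘ (+ 1) q-1) ⟩
  ℚᵘ.mkℚᵘ (+ 1) q-1        ≤⟨ ℚᵘ.*≤* (ℤ.+≤+ (ℕₚ.*-monoˡ-≤ (suc q-1) {1} {suc p} (ℕ.s≤s ℕ.z≤n))) ⟩
  ℚ.toℚᵘ ε                 ∎)
  where open ℚᵘₚ.≤-Reasoning
1/denominator≤ (ℚ.mkℚ (+ 0) _ _)       (ℚ.*<* (ℤ.+<+ ()))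
1/denominator≤ (ℚ.mkℚ ℤ.-[1+ _ ] _ _)  (ℚ.*<* ())

γ-upper : ∀ {n} d k (F : Vec Bool n → Bool) {B} → 0ℚ ≤ℚ B → All (λ Q → agr k F Q ≤ℚ B) (polys n d k) → γ d k F ≤ℚ B
γ-upper {n} d k F {B} 0≤B = go (polys n d k)
  where
  go : ∀ L → All (λ Q → agr k F Q ≤ℚ B) L → foldr (λ Q r → agr k F Q ℚ.⊔ r) 0ℚ L ≤ℚ B
  go []      []         = 0≤B
  go (Q ∷ L) (le ∷ les) = ℚₚ.⊔-lub le (go L les)

γ-lower : ∀ {n} d k (F : Vec Bool n → Bool) {Q} → Q ∈ polys n d k → agr k F Q ≤ℚ γ d k F
γ-lower {n} d k F {Q} = go (polys n d k)
  where
  go : ∀ L → Q ∈ L → agr k F Q ≤ℚ foldr (λ Q r → agr k F Q ℚ.⊔ r) 0ℚ L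
  go (Q ∷ L) (here refl) = ℚₚ.p≤p⊔q (agr k F Q) _
  go (R ∷ L) (there Q∈L) = ℚₚ.≤-trans (go L Q∈L) (ℚₚ.p≤q⊔p (agr k F R) _)

minus-≤ : ∀ p q ε → p ≤ℚ q + ε → p - ε ≤ℚ q
minus-≤ p q ε le = ℚₚ.≤-trans (ℚₚ.+-monoˡ-≤ (ℚ.- ε) le) (ℚₚ.≤-reflexive (trans (ℚₚ.+-assoc q ε (ℚ.- ε))
  (trans (cong (λ x → q + x) (ℚₚ.+-inverseʳ ε)) (ℚₚ.+-identityʳ q))))

lower-fraction : ∀ A P ε .{{_ : NonZero P}} → 0ℚ <ℚ ε →
  12 * ℚ.↧ₙ ε * P ≤ 16 * ℚ.↧ₙ ε * A ℕ.+ 16 * P → (+ 3 / 4) - ε ≤ℚ (+ A / P)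
lower-fraction A P ε 0<ε le = minus-≤ (+ 3 / 4) (+ A / P) ε
  (ℚₚ.≤-trans (fraction-≤ 3 4 A P 1 e (ℕₚ.*-cancelˡ-≤ 4 (subst₂ _≤_ (left e P) (right e A P) le)))
              (ℚₚ.+-monoʳ-≤ (+ A / P) (1/denominator≤ ε 0<ε)))
  where
  e = ℚ.↧ₙ ε
  left : ∀ e P → 12 * e * P ≡ 4 * (3 * (P * e))
  left = solve-∀
  right : ∀ e A P → 16 * e * A ℕ.+ 16 * P ≡ 4 * ((A * e ℕ.+ 1 * P) * 4)
  right = solve-∀

upper-fraction : ∀ A P ε .{{_ : NonZero P}} → 0ℚ <ℚ ε →
  16 * ℚ.↧ₙ ε * A ≤ (10 * ℚ.↧ₙ ε ℕ.+ 16) * P → (+ A / P) ≤ℚ (+ 5 / 8) + ε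
upper-fraction A P ε 0<ε le =
  ℚₚ.≤-trans (fraction-≤ A P 5 8 1 e (ℕₚ.*-cancelˡ-≤ 2 (subst₂ _≤_ (left e A) (right e P) le)))
             (ℚₚ.+-monoʳ-≤ (+ 5 / 8) (1/denominator≤ ε 0<ε))
  where
  e = ℚ.↧ₙ ε
  left : ∀ e A → 16 * e * A ≡ 2 * (A * (8 * e))
  left = solve-∀
  right : ∀ e P → (10 * e ℕ.+ 16) * P ≡ 2 * ((5 * e ℕ.+ 1 * 8) * P)
  right = solve-∀

theorem3p4 : (d : ℕ) → (∃ λ j → d ≡ 2 ^ j) →
    (ε : ℚ) → 0ℚ <ℚ ε →
    ∃ λ (N : ℕ) → (n : ℕ) → N ≤ n →
    Σ (Vec Bool (2 * n) → Bool) λ F →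
    ((+ 3 / 4) - ε ≤ℚ γ (2 * d) 2 F) × (γ (3 * d ∸ 1) 1 F ≤ℚ (+ 5 / 8) + ε)
theorem3p4 d (j , refl) ε 0<ε =
  let N₁ , lower = agreement-lower (frobenius j) (ℕₚ.m^n>0 2 j) e
      N₂ , upper = agreement-upper (frobenius j) (ℕₚ.m^n>0 2 j) e
  in N₁ ℕ.⊔ N₂ , λ n N≤n →
    let F = WitnessFunction d n
        instance _ = ℕₚ.m^n≢0 2 (2 * n)
    in F ,
       ℚₚ.≤-trans
         (lower-fraction (agreement 2 F (ElementaryPoly d n)) (2 ^ (2 * n)) ε 0<ε (lower n (ℕₚ.m⊔n≤o⇒m≤o N₁ N₂ N≤n)))
         (γ-lower (2 * d) 2 F (ElementaryPoly-∈ d n)) ,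
       γ-upper (3 * d ∸ 1) 1 F
         -- The maximum starts at 0, so the bound 5/8 + ε has to be nonnegative; this is the case of
         -- an agreement 0/1.
         (upper-fraction 0 1 ε 0<ε (subst (_≤ (10 * e ℕ.+ 16) * 1) (sym (ℕₚ.*-zeroʳ (16 * e))) ℕ.z≤n))
         (All.map (λ {Q} → upper-fraction (agreement 1 F Q) (2 ^ (2 * n)) ε 0<ε) (upper n (ℕₚ.m⊔n≤o⇒n≤o N₁ N₂ N≤n)))
  where
  e = ℚ.↧ₙ ε
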